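{- For every $(2,3)$-bipartite graph $G$, $ch'_s(G)\leq 6$.
   Context: Graphs are finite and simple. A $(2,3)$-bipartite graph is a bipartite graph $G$ with a bipartition $(A,B)$ such that $\max\{\deg_G(v)\mid v\in A\}\le 2$ and $\max\{\deg_G(v)\mid v\in B\}\le 3$. A strong edge coloring of a graph $G$ is an edge coloring such that each color class is an induced matching of $G$. The list strong chromatic index $ch'_s(G)$ is the smallest integer $k$ such that for every list assignment $L$ on $E(G)$ satisfying $|L(e)|\ge k$ for all $e\in E(G)$, there is a strong edge coloring $\varphi$ of $G$ with $\varphi(e)\in L(e)$ for every edge $e$ of $G$. -}

module Defs where

open import Data.Bool using (Bool; false; T)
open import Data.Bool.Properties using (T-irrelevant; T?)
open import Data.Empty using (⊥-elim)
open import Data.Fin using (Fin; zero; suc; toℕ; combine; remQuot; finToFun; funToFin; inject≤; _<_)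
open import Data.Fin.Properties as Finₚ using (all?; any?; toℕ-injective; remQuot-combine; finToFun-funToFin; inject≤-injective; pigeonhole)
open import Data.Fin.Subset using (Subset; ∣_∣; ∁) renaming (_∈_ to _∈ₛ_)
open import Data.Fin.Subset.Properties using () renaming (_∈?_ to _∈ₛ?_)
open import Data.List using (List; []; _∷_; length; map; filter; concatMap; allFin; lookup; tabulate; cartesianProduct)
open import Data.List.Extrema.Nat using (max)
open import Data.List.Membership.Propositional using (_∈_; _∉_; lose)
open import Data.List.Membership.Propositional.Properties using (∈-lookup; ∈-tabulate⁺; ∈-tabulate⁻; ∈-concatMap⁺; ∈-cartesianProduct⁺; ∈-allFin)
open import Data.List.Properties using (length-tabulate)
open import Data.List.Relation.Unary.All as All using ([]; _∷_)
open import Data.List.Relation.Unary.AllPairs using ([]; _∷_)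
open import Data.List.Relation.Unary.Any as Any using (here; index)
open import Data.List.Relation.Unary.Any.Properties using (lookup-index)
open import Data.List.Relation.Unary.Unique.Propositional using (Unique)
open import Data.List.Relation.Unary.Unique.Propositional.Properties using (tabulate⁺)
open import Data.Nat as ℕ using (ℕ; _≤_; _*_; z≤n; s≤s)
open import Data.List.Membership.DecPropositional ℕ._≟_ using (_∈?_)
open import Data.Nat.Properties as ℕₚ using (≤-refl; ≤-trans; ≤-reflexive)
open import Data.Product using (∃; _×_; _,_; proj₁; proj₂; uncurry)
open import Data.Sum using (_⊎_; inj₁; inj₂)
import Data.Vec as Vec
open import Function using (_∘_; id)
open import Level using (0ℓ)
open import Relation.Binary.PropositionalEquality using (_≡_; _≢_; _≗_; refl; sym; trans; cong; cong₂; subst)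
open import Relation.Nullary using (Dec; yes; no; contradiction)
open import Relation.Nullary.Decidable using (map′; _×-dec_; _⊎-dec_; _→-dec_; ¬?; decidable-stable)
open import Relation.Unary using (Pred; Decidable)

record Graph : Set where
  field
    order       : ℕ
    adj         : Fin order → Fin order → Bool
    symmetric   : ∀ u v → adj u v ≡ adj v u
    irreflexive : ∀ v → adj v v ≡ false

  Vertex : Set
  Vertex = Fin order

  neighbours : Vertex → Subset order
  neighbours v = Vec.tabulate (adj v)

  degree : Vertex → ℕ
  degree v = ∣ neighbours v ∣

  -- The maximum over the empty set is taken to be 0.
  maxDegreeOn : Subset order → ℕ
  maxDegreeOn S = max 0 (map degree (filter (_∈ₛ? S) (allFin order)))

  IsBipartition : Subset order → Subset order → Set
  IsBipartition A B = B ≡ ∁ A ×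
    (∀ u v → T (adj u v) → (u ∈ₛ A × v ∈ₛ B) ⊎ (u ∈ₛ B × v ∈ₛ A))

  -- Each unordered edge {u , v} is represented exactly once, by its increasing
  -- pair of ends; both proof fields are propositions.
  record Edge : Set where
    constructor edge
    field
      lo hi    : Vertex
      lo<hi    : lo < hi
      adjacent : T (adj lo hi)

  _∈ᵉ_ : Vertex → Edge → Set
  v ∈ᵉ e = v ≡ Edge.lo e ⊎ v ≡ Edge.hi e

  IsMatching : Pred Edge 0ℓ → Set
  IsMatching M = ∀ e f v → M e → M f → v ∈ᵉ e → v ∈ᵉ f → e ≡ f

  Covered : Pred Edge 0ℓ → Vertex → Set
  Covered M v = ∃ λ e → M e × v ∈ᵉ e

  -- The subgraph induced by the vertices covered by M has no edges other than
  -- those of M.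
  IsInducedMatching : Pred Edge 0ℓ → Set
  IsInducedMatching M = IsMatching M ×
    (∀ g → Covered M (Edge.lo g) → Covered M (Edge.hi g) → M g)

  IsStrongEdgeColouring : {C : Set} → (Edge → C) → Set
  IsStrongEdgeColouring φ = ∀ c → IsInducedMatching (λ e → φ e ≡ c)

  -- Colours are natural numbers; a finite set of colours is a duplicate-free list.
  StrongChoosable : ℕ → Set
  StrongChoosable k =
    (L : Edge → List ℕ) → (∀ e → Unique (L e)) → (∀ e → k ≤ length (L e)) →
    ∃ λ (φ : Edge → ℕ) → IsStrongEdgeColouring φ × (∀ e → φ e ∈ L e)

IsBipartiteWithDegrees : ℕ → ℕ → Graph → Set
IsBipartiteWithDegrees a b G = ∃ λ A → ∃ λ B →
  IsBipartition A B × maxDegreeOn A ≤ a × maxDegreeOn B ≤ b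
  where open Graph G

IsSmallest : (ℕ → Set) → ℕ → Set
IsSmallest P k = P k × (∀ j → P j → k ≤ j)

private
  searchSmallest : {P : ℕ → Set} → Decidable P → ∀ n → ∃ (IsSmallest P) ⊎ (∀ j → P j → n ≤ j)
  searchSmallest P? ℕ.zero = inj₂ λ _ _ → z≤n
  searchSmallest {P} P? (ℕ.suc n) with searchSmallest P? n
  ... | inj₁ found = inj₁ found
  ... | inj₂ above with P? n
  ...   | yes Pn = inj₁ (n , Pn , above)
  ...   | no ¬Pn = inj₂ λ j Pj → ℕₚ.≤∧≢⇒< (above j Pj) λ { refl → ¬Pn Pj }

  smallest : {P : ℕ → Set} → Decidable P → ∀ n → P n → ∃ (IsSmallest P)
  smallest P? n Pn with searchSmallest P? (ℕ.suc n)
  ... | inj₁ found = found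
  ... | inj₂ above = contradiction (above n Pn) (ℕₚ.<⇒≱ ℕₚ.≤-refl)

  module _ {m n : ℕ} {P : (Fin m → Fin n) → Set}
           (resp : ∀ {f g} → f ≗ g → P f → P g) (P? : Decidable P) where

    allFun? : Dec (∀ f → P f)
    allFun? = map′ (λ h f → resp (finToFun-funToFin f) (h (funToFin f))) (λ h c → h (finToFun c))
                   (all? (λ c → P? (finToFun c)))

    anyFun? : Dec (∃ P)
    anyFun? = map′ (λ (c , p) → finToFun c , p)
                   (λ (f , p) → funToFin f , resp (λ i → sym (finToFun-funToFin f i)) p)
                   (any? (λ c → P? (finToFun c)))

  lookup-injective : {A : Set} {xs : List A} → Unique xs →
                     ∀ i j → lookup xs i ≡ lookup xs j → i ≡ j
  lookup-injective (_ ∷ _) zero zero _ = refl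
  lookup-injective {xs = _ ∷ xs} (x∉ ∷ _) zero (suc j) eq = contradiction eq (All.lookup x∉ (∈-lookup {xs = xs} j))
  lookup-injective {xs = _ ∷ xs} (x∉ ∷ _) (suc i) zero eq = contradiction (sym eq) (All.lookup x∉ (∈-lookup {xs = xs} i))
  lookup-injective (_ ∷ u) (suc i) (suc j) eq = cong suc (lookup-injective u i j eq)

  fresh : {xs ys : List ℕ} → Unique xs → length ys ℕ.< length xs → ∃ λ x → x ∈ xs × x ∉ ys
  fresh {xs} {ys} uniq lt with any? (λ i → ¬? (lookup xs i ∈? ys))
  ... | yes (i , i∉) = lookup xs i , ∈-lookup i , i∉
  ... | no none = ⊥-elim (Finₚ.<⇒≢ i<j (lookup-injective uniq i j same))
    where
    into : ∀ i → lookup xs i ∈ ys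
    into i = decidable-stable (lookup xs i ∈? ys) λ i∉ → none (i , i∉)
    clash = pigeonhole lt (index ∘ into)
    i = proj₁ clash
    j = proj₁ (proj₂ clash)
    i<j = proj₁ (proj₂ (proj₂ clash))
    same : lookup xs i ≡ lookup xs j
    same = trans (lookup-index (into i))
          (trans (cong (lookup ys) (proj₂ (proj₂ (proj₂ clash)))) (sym (lookup-index (into j))))

  distinctChoice : ∀ m (L : Fin m → List ℕ) → (∀ i → Unique (L i)) → (∀ i → m ≤ length (L i)) →
                   ∃ λ (φ : Fin m → ℕ) → (∀ i j → φ i ≡ φ j → i ≡ j) × (∀ i → φ i ∈ L i)
  distinctChoice ℕ.zero L uniq big = (λ ()) , (λ ()) , λ ()
  distinctChoice (ℕ.suc m) L uniq big
    with distinctChoice m (L ∘ suc) (uniq ∘ suc) (λ i → ℕₚ.<⇒≤ (big (suc i)))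
  ... | φ , inj , mem with fresh {ys = tabulate φ} (uniq zero)
                             (≤-trans (s≤s (≤-reflexive (length-tabulate φ))) (big zero))
  ...   | x , x∈ , x∉ = ψ , ψ-inj , ψ-mem
    where
    ψ : Fin (ℕ.suc m) → ℕ
    ψ zero = x
    ψ (suc i) = φ i
    avoids : ∀ i → x ≢ φ i
    avoids i refl = x∉ (∈-tabulate⁺ i)
    ψ-inj : ∀ i j → ψ i ≡ ψ j → i ≡ j
    ψ-inj zero zero _ = refl
    ψ-inj zero (suc j) eq = contradiction eq (avoids j)
    ψ-inj (suc i) zero eq = contradiction (sym eq) (avoids i)
    ψ-inj (suc i) (suc j) eq = cong suc (inj i j eq)
    ψ-mem : ∀ i → ψ i ∈ L i
    ψ-mem zero = x∈
    ψ-mem (suc i) = mem i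

  -- Any N natural numbers can be renamed into Fin (suc N) without changing
  -- which of them are equal.
  module Rename {N : ℕ} (g : Fin N → ℕ) where
    code : ℕ → Fin (ℕ.suc (length (tabulate g)))
    code x with x ∈? tabulate g
    ... | yes p = suc (index p)
    ... | no _ = zero

    code-injective : ∀ {x y} → x ∈ tabulate g → y ∈ tabulate g → code x ≡ code y → x ≡ y
    code-injective {x} {y} x∈ y∈ eq with x ∈? tabulate g | y ∈? tabulate g
    ... | no x∉ | _ = contradiction x∈ x∉
    ... | yes _ | no y∉ = contradiction y∈ y∉
    ... | yes p | yes q = trans (lookup-index p)
      (trans (cong (lookup (tabulate g)) (Finₚ.suc-injective eq)) (sym (lookup-index q)))

    rename : Fin N → Fin (ℕ.suc N)
    rename i = subst (Fin ∘ ℕ.suc) (length-tabulate g) (code (g i))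

    rename⁺ : ∀ i j → g i ≡ g j → rename i ≡ rename j
    rename⁺ i j eq = cong (subst (Fin ∘ ℕ.suc) (length-tabulate g) ∘ code) eq

    rename⁻ : ∀ i j → rename i ≡ rename j → g i ≡ g j
    rename⁻ i j eq = code-injective (∈-tabulate⁺ i) (∈-tabulate⁺ j) (subst-inj (length-tabulate g) eq)
      where
      subst-inj : ∀ {a b : ℕ} (p : a ≡ b) {x y : Fin (ℕ.suc a)} →
                  subst (Fin ∘ ℕ.suc) p x ≡ subst (Fin ∘ ℕ.suc) p y → x ≡ y
      subst-inj refl eq = eq

  module Existence (G : Graph) where
    open Graph G
    open Edge

    edge-≡ : ∀ {e f : Edge} → lo e ≡ lo f → hi e ≡ hi f → e ≡ f
    edge-≡ {edge l h p q} {edge _ _ p′ q′} refl refl =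
      cong₂ (edge l h) (Finₚ.<-irrelevant p p′) (T-irrelevant q q′)

    _≟ᵉ_ : (e f : Edge) → Dec (e ≡ f)
    e ≟ᵉ f = map′ (uncurry edge-≡) (λ { refl → refl , refl })
                  ((lo e Finₚ.≟ lo f) ×-dec (hi e Finₚ.≟ hi f))

    _∈ᵉ?_ : ∀ v e → Dec (v ∈ᵉ e)
    v ∈ᵉ? e = (v Finₚ.≟ lo e) ⊎-dec (v Finₚ.≟ hi e)

    edgesAt : Vertex × Vertex → List Edge
    edgesAt (u , v) with u Finₚ.<? v | T? (adj u v)
    ... | yes p | yes q = edge u v p q ∷ []
    ... | yes _ | no _ = []
    ... | no _ | _ = []

    ∈-edgesAt : ∀ e → e ∈ edgesAt (lo e , hi e)
    ∈-edgesAt (edge u v p q) with u Finₚ.<? v | T? (adj u v)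
    ... | yes _ | yes _ = here (edge-≡ refl refl)
    ... | yes _ | no ¬q = contradiction q ¬q
    ... | no ¬p | _ = contradiction p ¬p

    edges : List Edge
    edges = concatMap edgesAt (cartesianProduct (allFin order) (allFin order))

    size : ℕ
    size = length edges

    ∈-edges : ∀ e → e ∈ edges
    ∈-edges e = ∈-concatMap⁺ edgesAt
      (lose (∈-cartesianProduct⁺ (∈-allFin (lo e)) (∈-allFin (hi e))) (∈-edgesAt e))

    at : Fin size → Edge
    at = lookup edges

    ix : Edge → Fin size
    ix e = index (∈-edges e)

    at-ix : ∀ e → at (ix e) ≡ e
    at-ix e = sym (lookup-index (∈-edges e))

    ix-injective : ∀ {e f} → ix e ≡ ix f → e ≡ f
    ix-injective {e} {f} eq = trans (sym (at-ix e)) (trans (cong at eq) (at-ix f))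

    allEdges? : {P : Edge → Set} → Decidable P → Dec (∀ e → P e)
    allEdges? {P} P? = map′ (λ h e → subst P (at-ix e) (h (ix e))) (λ h i → h (at i)) (all? (P? ∘ at))

    Strong : {C : Set} → (Edge → C) → Set
    Strong φ = (∀ e f v → φ e ≡ φ f → v ∈ᵉ e → v ∈ᵉ f → e ≡ f)
             × (∀ g e f → φ e ≡ φ f → lo g ∈ᵉ e → hi g ∈ᵉ f → φ g ≡ φ f)

    strong⁺ : {C : Set} {φ : Edge → C} → Strong φ → IsStrongEdgeColouring φ
    strong⁺ (M , I) c =
        (λ e f v p q → M e f v (trans p (sym q)))
      , λ { g (e , p , l) (f , q , h) → trans (I g e f (trans p (sym q)) l h) q }

    strong⁻ : {C : Set} {φ : Edge → C} → IsStrongEdgeColouring φ → Strong φ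
    strong⁻ {φ = φ} s =
        (λ e f v p → proj₁ (s (φ f)) e f v p refl)
      , λ g e f p l h → proj₂ (s (φ f)) g (e , p , l) (f , refl , h)

    strong-transfer : {C D : Set} {φ : Edge → C} {ψ : Edge → D} →
                      (∀ e f → φ e ≡ φ f → ψ e ≡ ψ f) → (∀ e f → ψ e ≡ ψ f → φ e ≡ φ f) →
                      Strong φ → Strong ψ
    strong-transfer to from (M , I) =
        (λ e f v p → M e f v (from e f p))
      , λ g e f p l h → to g f (I g e f (from e f p) l h)

    strong? : ∀ {n} (φ : Edge → Fin n) → Dec (Strong φ)
    strong? φ =
      allEdges? (λ e → allEdges? λ f → all? λ v →
        (φ e Finₚ.≟ φ f) →-dec ((v ∈ᵉ? e) →-dec ((v ∈ᵉ? f) →-dec (e ≟ᵉ f))))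
      ×-dec
      allEdges? (λ g → allEdges? λ e → allEdges? λ f →
        (φ e Finₚ.≟ φ f) →-dec ((lo g ∈ᵉ? e) →-dec ((hi g ∈ᵉ? f) →-dec (φ g Finₚ.≟ φ f))))

    choosable-size : StrongChoosable size
    choosable-size L uniq big with distinctChoice size (L ∘ at) (uniq ∘ at) (big ∘ at)
    ... | φ , inj , mem = φ ∘ ix , strong⁺ (matching , induced) ,
                          λ e → subst (λ e′ → φ (ix e) ∈ L e′) (at-ix e) (mem (ix e))
      where
      φ-inj : ∀ {e f} → φ (ix e) ≡ φ (ix f) → e ≡ f
      φ-inj = ix-injective ∘ inj _ _
      matching : ∀ e f v → φ (ix e) ≡ φ (ix f) → v ∈ᵉ e → v ∈ᵉ f → e ≡ f
      matching e f v p _ _ = φ-inj p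
      same : ∀ g e → lo g ∈ᵉ e → hi g ∈ᵉ e → g ≡ e
      same g e (inj₁ p) (inj₂ q) = edge-≡ p q
      same g e (inj₁ p) (inj₁ q) = contradiction (trans p (sym q)) (Finₚ.<⇒≢ (lo<hi g))
      same g e (inj₂ p) (inj₂ q) = contradiction (trans p (sym q)) (Finₚ.<⇒≢ (lo<hi g))
      same (edge _ _ p _) e (inj₂ refl) (inj₁ refl) = contradiction (lo<hi e) (Finₚ.<-asym p)
      induced : ∀ g e f → φ (ix e) ≡ φ (ix f) → lo g ∈ᵉ e → hi g ∈ᵉ f → φ (ix g) ≡ φ (ix f)
      induced g e f p l h with φ-inj p
      ... | refl = cong (φ ∘ ix) (same g e l h)

    -- Choosability from lists of exactly k colours, out of finitely many.
    module _ (k : ℕ) where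
      N : ℕ
      N = size * k

      pair : Fin size → Fin k → Fin N
      pair = combine

      colour : {C : Set} → (Fin N → C) → (Fin size → Fin k) → Edge → C
      colour f p e = f (pair (ix e) (p (ix e)))

      Distinct : {C : Set} → (Fin N → C) → Set
      Distinct f = ∀ e i j → f (pair e i) ≡ f (pair e j) → i ≡ j

      FinitelyChoosable : Set
      FinitelyChoosable = (f : Fin N → Fin (ℕ.suc N)) → Distinct f → ∃ λ p → Strong (colour f p)

      finitelyChoosable? : Dec FinitelyChoosable
      finitelyChoosable? = allFun?
        (λ {f} {g} f≗g h d →
          let p , s = h λ e i j eq → d e i j (trans (sym (f≗g _)) (trans eq (f≗g _)))
          in p , strong-transfer {φ = colour f p} {ψ = colour g p}
                   (λ e f eq → trans (sym (f≗g _)) (trans eq (f≗g _)))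
                   (λ e f eq → trans (f≗g _) (trans eq (sym (f≗g _)))) s)
        λ f →
          all? (λ e → all? λ i → all? λ j →
            (f (pair e i) Finₚ.≟ f (pair e j)) →-dec (i Finₚ.≟ j))
          →-dec
          anyFun?
            (λ {p} {q} p≗q →
              let eqs : colour f p ≗ colour f q
                  eqs e = cong (f ∘ pair (ix e)) (p≗q (ix e))
              in strong-transfer {φ = colour f p} {ψ = colour f q}
                   (λ a b eq → trans (sym (eqs a)) (trans eq (eqs b)))
                   (λ a b eq → trans (eqs a) (trans eq (sym (eqs b)))))
            (λ p → strong? (colour f p))

      toFinite : StrongChoosable k → FinitelyChoosable
      toFinite ch f distinct =
        p , strong-transfer {φ = φ} {ψ = colour f p}
              (λ a b eq → toℕ-injective (trans (sym (hit a)) (trans eq (hit b))))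
              (λ a b eq → trans (hit a) (trans (cong toℕ eq) (sym (hit b))))
              (strong⁻ s)
        where
        slot : Edge → Fin k → ℕ
        slot e i = toℕ (f (pair (ix e) i))
        choice = ch (λ e → tabulate (slot e))
                    (λ e → tabulate⁺ (λ {i} {j} eq → distinct (ix e) i j (toℕ-injective eq)))
                    (λ e → ≤-reflexive (sym (length-tabulate (slot e))))
        φ = proj₁ choice
        s = proj₁ (proj₂ choice)
        mem = proj₂ (proj₂ choice)
        p : Fin size → Fin k
        p i = proj₁ (∈-tabulate⁻ (mem (at i)))
        hit : ∀ e → φ e ≡ toℕ (colour f p e)
        hit e = trans (proj₂ (∈-tabulate⁻ (mem e)))
                      (cong (slot e) (cong (λ e′ → proj₁ (∈-tabulate⁻ (mem e′))) (sym (at-ix e))))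

      fromFinite : FinitelyChoosable → StrongChoosable k
      fromFinite fc L uniq big =
        φ , strong⁺ (strong-transfer {φ = colour rename p} {ψ = φ}
              (λ a b eq → trans (φ-g a) (trans (rename⁻ _ _ eq) (sym (φ-g b))))
              (λ a b eq → rename⁺ _ _ (trans (sym (φ-g a)) (trans eq (φ-g b)))) s)
          , λ e → ∈-lookup (inject≤ (p (ix e)) (big e))
        where
        slot : ∀ e → Fin k → ℕ
        slot e i = lookup (L e) (inject≤ i (big e))
        g : Fin N → ℕ
        g c = slot (at (proj₁ (remQuot {size} k c))) (proj₂ (remQuot {size} k c))
        g-combine : ∀ i j → g (pair i j) ≡ slot (at i) j
        g-combine i j = cong (λ (a , b) → slot (at a) b) (remQuot-combine i j)
        open Rename g
        choice = fc rename λ e i j eq →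
          inject≤-injective (big (at e)) (big (at e)) i j
            (lookup-injective (uniq (at e)) _ _
              (trans (sym (g-combine e i)) (trans (rename⁻ _ _ eq) (g-combine e j))))
        p = proj₁ choice
        s = proj₂ choice
        φ : Edge → ℕ
        φ e = slot e (p (ix e))
        φ-g : ∀ e → φ e ≡ g (pair (ix e) (p (ix e)))
        φ-g e = sym (trans (g-combine _ _) (cong (λ e′ → slot e′ (p (ix e))) (at-ix e)))

    strongChoosable? : Decidable StrongChoosable
    strongChoosable? k = map′ (fromFinite k) (toFinite k) (finitelyChoosable? k)

-- Constructively, a smallest k exists because choosability is decidable (only
-- finitely many list assignments matter up to renaming colours) and because G
-- is choosable from lists as large as its number of edges.
abstract
  smallestStrongChoosable : (G : Graph) → ∃ (IsSmallest (Graph.StrongChoosable G))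
  smallestStrongChoosable G = smallest strongChoosable? size choosable-size
    where open Existence G

ch′ₛ : Graph → ℕ
ch′ₛ G = proj₁ (smallestStrongChoosable G)

ch′ₛ-smallest : (G : Graph) → IsSmallest (Graph.StrongChoosable G) (ch′ₛ G)
ch′ₛ-smallest G = proj₂ (smallestStrongChoosable G)

{-# OPTIONS --safe #-}

-- Contract A: the edges of G become the darts of a multigraph H on B of maximum
-- degree 3, and two darts conflict when they have the same base or one of them
-- leads to the base of the other.  A dart has up to 7 conflicts, one too many
-- for a greedy colouring from lists of size 6, but colouring the darts inside a
-- set S of vertices of H is possible by induction on S.  If a vertex has at
-- most two darts, colour S without it and then its darts greedily, those
-- directed towards it first.  At a cubic vertex the six new darts are left with
-- lists of size 2 (inward) and 4 (outward); these can be coloured as soon as two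
-- of the outward lists differ.  Parallel edges enlarge the lists, which gives
-- the difference; otherwise remove two adjacent cubic vertices, and colour the
-- darts at one of them in such a way that the lists at the other differ.

module Submission where

open import Defs
open import Data.Nat using (_≤_)
open import Data.Bool using (Bool; true; false; not; T)
open import Data.Bool.Properties using (T-irrelevant; T?; T-≡; not-involutive; not-¬) renaming (_≟_ to _≟ᵇ_)
open import Data.Fin as Fin using ()
open import Data.Fin.Properties as Finₚ using (any?)
open import Data.Fin.Subset using (Subset; ∣_∣) renaming (_∈_ to _∈ₛ_)
open import Data.Fin.Subset.Properties using (x∈p⇒x∉∁p; x∈p∧x≢y⇒x∈p-y; x∈p⇒∣p-x∣<∣p∣) renaming (_∈?_ to _∈ₛ?_)
open import Data.List using (List; []; _∷_; _++_; length; map; filter; take; allFin; cartesianProduct)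
open import Data.List.Extrema.Nat using (xs≤max)
open import Data.List.Membership.Propositional using (_∈_; _∉_; lose)
open import Data.List.Membership.Propositional.Properties using (∈-∃++; ∈-++⁺ˡ; ∈-++⁺ʳ; ∈-++⁻; ∈-filter⁺; ∈-filter⁻; ∈-map⁺; ∈-allFin; ∈-cartesianProduct⁺)
open import Data.List.Properties using (length-++; length-map; length-take; take++drop≡id; length-filter; filter-notAll)
open import Data.List.Relation.Binary.Subset.Propositional using (_⊆_)
open import Data.List.Relation.Unary.All as All using (All; []; _∷_)
open import Data.List.Relation.Unary.All.Properties using (¬Any⇒All¬)
open import Data.List.Relation.Unary.AllPairs using (AllPairs; []; _∷_)
open import Data.List.Relation.Unary.Any using (here; there)
open import Data.List.Relation.Unary.Unique.Propositional using (Unique)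
open import Data.List.Relation.Unary.Unique.Propositional.Properties using (filter⁺; take⁺)
open import Data.Nat as ℕ using (ℕ; suc; _+_; _∸_; _<_; _≤?_; _<?_; z≤n; s≤s)
open import Data.List.Membership.DecPropositional ℕ._≟_ using (_∈?_)
open import Data.Nat.Properties as ℕₚ using (≤-refl; ≤-trans; ≤-reflexive)
open import Data.Product using (∃; _×_; _,_; proj₁; proj₂; uncurry)
open import Data.Product.Properties using (≡-dec)
open import Data.Sum using (_⊎_; inj₁; inj₂; [_,_]′)
open import Data.Vec.Properties using (lookup⇒[]=; lookup∘tabulate)
open import Function using (_∘_; id; Equivalence)
open import Relation.Binary.Definitions using (DecidableEquality)
open import Relation.Binary.PropositionalEquality
open import Relation.Nullary using (¬_; Dec; yes; no; contradiction)
open import Relation.Nullary.Decidable using (True; toWitness; map′; _×-dec_; _⊎-dec_; ¬?; decidable-stable; from-no)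
open import Relation.Unary using (Decidable)

-- Palettes: lists with a guaranteed number of distinct colours.

unique-⊆-length : {xs ys : List ℕ} → Unique xs → (∀ {x} → x ∈ xs → x ∈ ys) → length xs ≤ length ys
unique-⊆-length {[]} _ _ = z≤n
unique-⊆-length {x ∷ xs} (x∉ ∷ uniq) sub with ∈-∃++ (sub (here refl))
... | as , bs , refl = ≤-trans (s≤s (unique-⊆-length uniq sub′)) (≤-reflexive shorter)
  where
  sub′ : ∀ {y} → y ∈ xs → y ∈ as ++ bs
  sub′ y∈ with ∈-++⁻ as (sub (there y∈))
  ... | inj₁ y∈as = ∈-++⁺ˡ y∈as
  ... | inj₂ (here refl) = contradiction refl (All.lookup x∉ y∈)
  ... | inj₂ (there y∈bs) = ∈-++⁺ʳ as y∈bs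
  shorter : suc (length (as ++ bs)) ≡ length (as ++ x ∷ bs)
  shorter = begin
    suc (length (as ++ bs))       ≡⟨ cong suc (length-++ as) ⟩
    suc (length as + length bs)   ≡⟨ ℕₚ.+-suc (length as) (length bs) ⟨
    length as + length (x ∷ bs)   ≡⟨ length-++ as ⟨
    length (as ++ x ∷ bs)         ∎
    where open ≡-Reasoning

Palette : ℕ → List ℕ → Set
Palette k xs = Unique xs × k ≤ length xs

weaken : ∀ {k xs} j {_ : True (j ≤? k)} → Palette k xs → Palette j xs
weaken _ {j≤k} (uniq , k≤) = uniq , ≤-trans (toWitness j≤k) k≤

infixl 6 _∖_
_∖_ : List ℕ → List ℕ → List ℕ
xs ∖ ys = filter (λ x → ¬? (x ∈? ys)) xs

∈-∖⁻ : ∀ {x xs} ys → x ∈ xs ∖ ys → x ∈ xs × x ∉ ys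
∈-∖⁻ {xs = xs} ys = ∈-filter⁻ (λ x → ¬? (x ∈? ys)) {xs = xs}

∈-∖⁺ : ∀ {x xs} ys → x ∈ xs → x ∉ ys → x ∈ xs ∖ ys
∈-∖⁺ ys = ∈-filter⁺ (λ x → ¬? (x ∈? ys))

-- The bound is a numeral as soon as `k` and the length of `ys` are known, so the sizes 4 and 2 of
-- the lists left at a star come out by evaluation.
palette-∖ : ∀ {k xs} → Palette k xs → ∀ ys → Palette (k ∸ length ys) (xs ∖ ys)
palette-∖ {k} {xs} (uniq , k≤) ys =
  filter⁺ (λ x → ¬? (x ∈? ys)) uniq , ℕₚ.m≤n+o⇒m∸n≤o k (length ys) (≤-trans k≤ bound)
  where
  covered : ∀ {x} → x ∈ xs → x ∈ ys ++ (xs ∖ ys)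
  covered {x} x∈ with x ∈? ys
  ... | yes x∈ys = ∈-++⁺ˡ x∈ys
  ... | no x∉ys = ∈-++⁺ʳ ys (∈-∖⁺ ys x∈ x∉ys)
  bound : length xs ≤ length ys + length (xs ∖ ys)
  bound = ≤-trans (unique-⊆-length uniq covered) (≤-reflexive (length-++ ys))

palette-take : ∀ {k xs} → Palette k xs → Palette k (take k xs)
palette-take {k} {xs} (uniq , k≤) =
  take⁺ k uniq , ≤-reflexive (sym (trans (length-take k xs) (ℕₚ.m≤n⇒m⊓n≡m k≤)))

palette-choose : ∀ {k xs} → Palette k xs → ∀ ys → length ys < k → ∃ λ x → x ∈ xs × All (x ≢_) ys
palette-choose pal ys lt with palette-∖ pal ys
palette-choose {k} {xs} pal ys lt | _ , big with xs ∖ ys in eq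
... | [] = contradiction (≤-trans (ℕₚ.m<n⇒0<n∸m lt) big) λ ()
... | x ∷ _ with ∈-∖⁻ {xs = xs} ys (subst (x ∈_) (sym eq) (here refl))
...   | x∈ , x∉ = x , x∈ , ¬Any⇒All¬ ys x∉

choose : ∀ {k xs} → Palette k xs → ∀ ys → {_ : True (length ys <? k)} → ∃ λ x → x ∈ xs × All (x ≢_) ys
choose pal ys {lt} = palette-choose pal ys (toWitness lt)

-- Colouring the star at a cubic vertex.

Free : List ℕ → List ℕ → Set
Free os A = ∃ λ a → a ∈ A × All (a ≢_) os

-- Colours for the star at a cubic vertex: the three outward darts form a
-- triangle of conflicts, and every inward dart conflicts with all three.
record StarColours (O₁ O₂ O₃ A₁ A₂ A₃ : List ℕ) : Set where
  constructor star
  field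
    {o₁ o₂ o₃} : ℕ
    o₁∈ : o₁ ∈ O₁
    o₂∈ : o₂ ∈ O₂
    o₃∈ : o₃ ∈ O₃
    o₁≢o₂ : o₁ ≢ o₂
    o₁≢o₃ : o₁ ≢ o₃
    o₂≢o₃ : o₂ ≢ o₃
    free₁ : Free (o₁ ∷ o₂ ∷ o₃ ∷ []) A₁
    free₂ : Free (o₁ ∷ o₂ ∷ o₃ ∷ []) A₂
    free₃ : Free (o₁ ∷ o₂ ∷ o₃ ∷ []) A₃

rotate : ∀ {O₁ O₂ O₃ A₁ A₂ A₃} → StarColours O₁ O₂ O₃ A₁ A₂ A₃ → StarColours O₁ O₂ O₃ A₂ A₃ A₁
rotate (star o₁∈ o₂∈ o₃∈ n₁₂ n₁₃ n₂₃ f₁ f₂ f₃) = star o₁∈ o₂∈ o₃∈ n₁₂ n₁₃ n₂₃ f₂ f₃ f₁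

-- For O₁ = O₂ = O₃ such colours need not exist, so z is needed: it is used
-- for two inward darts at once if possible, and for o₁ otherwise.
module _ {O₁ O₂ O₃ : List ℕ} (P₁ : Palette 4 O₁) (P₂ : Palette 4 O₂) (P₃ : Palette 4 O₃)
         {z : ℕ} (z∈O₁ : z ∈ O₁) (z∉O₂ : z ∉ O₂) where

  private
    -- Two inward darts sharing `z` forbid only one colour. With `y` reserved for the third, each
    -- outward dart avoids at most three colours: `z` is absent from `O₂` anyway.
    z-shared : ∀ {A₁ A₂ A₃} → z ∈ A₁ → z ∈ A₂ → Palette 2 A₃ → StarColours O₁ O₂ O₃ A₁ A₂ A₃
    z-shared z∈A₁ z∈A₂ A₃
      with y , y∈ , [] ← choose A₃ []
      with o₁ , o₁∈ , o₁≢z ∷ o₁≢y ∷ [] ← choose P₁ (z ∷ y ∷ [])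
      with o₃ , o₃∈ , o₃≢z ∷ o₃≢y ∷ o₃≢o₁ ∷ [] ← choose P₃ (z ∷ y ∷ o₁ ∷ [])
      with o₂ , o₂∈ , o₂≢y ∷ o₂≢o₁ ∷ o₂≢o₃ ∷ [] ← choose P₂ (y ∷ o₁ ∷ o₃ ∷ [])
      = star o₁∈ o₂∈ o₃∈ (≢-sym o₂≢o₁) (≢-sym o₃≢o₁) o₂≢o₃
             (z , z∈A₁ , z-free) (z , z∈A₂ , z-free)
             (y , y∈ , ≢-sym o₁≢y ∷ ≢-sym o₂≢y ∷ ≢-sym o₃≢y ∷ [])
      where z-free = ≢-sym o₁≢z ∷ (λ { refl → z∉O₂ o₂∈ }) ∷ ≢-sym o₃≢z ∷ []

    ∈∉⇒≢ : ∀ {x y : ℕ} {xs} → x ∈ xs → y ∉ xs → x ≢ y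
    ∈∉⇒≢ x∈ y∉ refl = y∉ x∈

    -- Taking `z` for `o₁` costs nothing in `A₂` and `A₃`. A further colour `x` of `O₃` either
    -- serves both of these inward darts, or is missing from one of their lists and becomes `o₃` at
    -- no cost there.
    z-rare : ∀ {A₁ A₂ A₃} → Palette 2 A₁ → Palette 2 A₂ → Palette 2 A₃ →
             z ∉ A₂ → z ∉ A₃ → StarColours O₁ O₂ O₃ A₁ A₂ A₃
    z-rare {A₁} {A₂} {A₃} P Q R z∉A₂ z∉A₃
      with a₁ , a₁∈ , a₁≢z ∷ [] ← choose P (z ∷ [])
      with x , x∈ , x≢z ∷ x≢a₁ ∷ [] ← choose P₃ (z ∷ a₁ ∷ [])
      with x ∈? A₂ | x ∈? A₃
    ... | yes x∈A₂ | yes x∈A₃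
      with o₃ , o₃∈ , o₃≢z ∷ o₃≢a₁ ∷ o₃≢x ∷ [] ← choose P₃ (z ∷ a₁ ∷ x ∷ [])
      with o₂ , o₂∈ , o₂≢a₁ ∷ o₂≢o₃ ∷ o₂≢x ∷ [] ← choose P₂ (a₁ ∷ o₃ ∷ x ∷ [])
      = star z∈O₁ o₂∈ o₃∈ (≢-sym (∈∉⇒≢ o₂∈ z∉O₂)) (≢-sym o₃≢z) o₂≢o₃
             (a₁ , a₁∈ , a₁≢z ∷ ≢-sym o₂≢a₁ ∷ ≢-sym o₃≢a₁ ∷ [])
             (x , x∈A₂ , x-free) (x , x∈A₃ , x-free)
      where x-free = x≢z ∷ ≢-sym o₂≢x ∷ ≢-sym o₃≢x ∷ []
    ... | yes _ | no x∉A₃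
      with a₂ , a₂∈ , a₂≢x ∷ [] ← choose Q (x ∷ [])
      with o₂ , o₂∈ , o₂≢a₁ ∷ o₂≢x ∷ o₂≢a₂ ∷ [] ← choose P₂ (a₁ ∷ x ∷ a₂ ∷ [])
      -- Two colours suffice here, since neither `z` nor `x` occurs in `A₃`.
      with a₃ , a₃∈ , a₃≢o₂ ∷ [] ← choose R (o₂ ∷ [])
      = star z∈O₁ o₂∈ x∈ (≢-sym (∈∉⇒≢ o₂∈ z∉O₂)) (≢-sym x≢z) o₂≢x
             (a₁ , a₁∈ , a₁≢z ∷ ≢-sym o₂≢a₁ ∷ ≢-sym x≢a₁ ∷ [])
             (a₂ , a₂∈ , ∈∉⇒≢ a₂∈ z∉A₂ ∷ ≢-sym o₂≢a₂ ∷ a₂≢x ∷ [])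
             (a₃ , a₃∈ , ∈∉⇒≢ a₃∈ z∉A₃ ∷ a₃≢o₂ ∷ ∈∉⇒≢ a₃∈ x∉A₃ ∷ [])
    ... | no x∉A₂ | _
      with a₃ , a₃∈ , a₃≢x ∷ [] ← choose R (x ∷ [])
      with o₂ , o₂∈ , o₂≢a₁ ∷ o₂≢x ∷ o₂≢a₃ ∷ [] ← choose P₂ (a₁ ∷ x ∷ a₃ ∷ [])
      with a₂ , a₂∈ , a₂≢o₂ ∷ [] ← choose Q (o₂ ∷ [])
      = star z∈O₁ o₂∈ x∈ (≢-sym (∈∉⇒≢ o₂∈ z∉O₂)) (≢-sym x≢z) o₂≢x
             (a₁ , a₁∈ , a₁≢z ∷ ≢-sym o₂≢a₁ ∷ ≢-sym x≢a₁ ∷ [])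
             (a₂ , a₂∈ , ∈∉⇒≢ a₂∈ z∉A₂ ∷ a₂≢o₂ ∷ ∈∉⇒≢ a₂∈ x∉A₂ ∷ [])
             (a₃ , a₃∈ , ∈∉⇒≢ a₃∈ z∉A₃ ∷ ≢-sym o₂≢a₃ ∷ a₃≢x ∷ [])

  star-colours : ∀ {A₁ A₂ A₃} → Palette 2 A₁ → Palette 2 A₂ → Palette 2 A₃ →
                 StarColours O₁ O₂ O₃ A₁ A₂ A₃
  star-colours {A₁} {A₂} {A₃} P Q R with z ∈? A₁ | z ∈? A₂ | z ∈? A₃
  ... | yes z∈A₁ | yes z∈A₂ | _        = z-shared z∈A₁ z∈A₂ R
  ... | yes z∈A₁ | no _     | yes z∈A₃ = rotate (z-shared z∈A₃ z∈A₁ Q)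
  ... | no _     | yes z∈A₂ | yes z∈A₃ = rotate (rotate (z-shared z∈A₂ z∈A₃ P))
  ... | _        | no z∉A₂  | no z∉A₃  = z-rare P Q R z∉A₂ z∉A₃
  ... | no z∉A₁  | yes _    | no z∉A₃  = rotate (rotate (z-rare Q R P z∉A₃ z∉A₁))
  ... | no z∉A₁  | no z∉A₂  | yes _    = rotate (z-rare R P Q z∉A₁ z∉A₂)

∈-swap : {A : Set} {x a b c : A} → x ∈ a ∷ b ∷ c ∷ [] → x ∈ a ∷ c ∷ b ∷ []
∈-swap (here eq) = here eq
∈-swap (there (here eq)) = there (there (here eq))
∈-swap (there (there (here eq))) = there (here eq)

∈-cycle : {A : Set} {x a b c : A} → x ∈ a ∷ b ∷ c ∷ [] → x ∈ b ∷ c ∷ a ∷ []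
∈-cycle (here eq) = there (there (here eq))
∈-cycle (there (here eq)) = here eq
∈-cycle (there (there (here eq))) = there (here eq)

take-⊆ : ∀ {xs : List ℕ} n → take n xs ⊆ xs
take-⊆ {xs} n {x} x∈ = subst (x ∈_) (take++drop≡id n xs) (∈-++⁺ˡ x∈)

length-take-≤ : ∀ n (xs : List ℕ) → length (take n xs) ≤ n
length-take-≤ n xs = ≤-trans (≤-reflexive (length-take n xs)) (ℕₚ.m⊓n≤m n (length xs))

-- A dart is an edge of the bipartite graph, based at its end in B, and rev is
-- the other edge at its end in A.  Fibres of base have at most three elements;
-- the siblings may coincide with each other or with the dart itself.
record DartSystem : Set₁ where
  infix 4 _≟ᵈ_ _≟ᵛ_ _~_
  field
    Dart Vertex    : Set
    _≟ᵈ_           : DecidableEquality Dart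
    _≟ᵛ_           : DecidableEquality Vertex
    search         : {Q : Dart → Set} → Decidable Q → Dec (∃ Q)
    vertices       : List Vertex
    base           : Dart → Vertex
    base∈vertices  : ∀ d → base d ∈ vertices
    rev            : Dart → Dart
    rev-involutive : ∀ d → rev (rev d) ≡ d
    base-rev       : ∀ d → base (rev d) ≢ base d
    sib₁ sib₂      : Dart → Dart
    base-sib₁      : ∀ d → base (sib₁ d) ≡ base d
    base-sib₂      : ∀ d → base (sib₂ d) ≡ base d
    siblings       : ∀ d {x} → base x ≡ base d → x ∈ d ∷ sib₁ d ∷ sib₂ d ∷ []

  _~_ : Dart → Dart → Set
  d ~ d′ = d ≢ d′ × (base d ≡ base d′ ⊎ base (rev d) ≡ base d′ ⊎ base d ≡ base (rev d′))

-- Partial colourings and their extension.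

module Colouring (system : DartSystem) (L : DartSystem.Dart system → List ℕ)
                 (palette : ∀ d → Palette 6 (L d)) where

  open DartSystem system

  infixl 5 _▸_ _▸*_
  infixl 8 _⊖_

  -- A partial colouring is a total function constrained only on `P`; its values elsewhere are
  -- arbitrary.
  record Proper (P : Dart → Set) (col : Dart → ℕ) : Set where
    constructor proper
    field
      listed   : ∀ {d} → P d → col d ∈ L d
      distinct : ∀ {d d′} → P d → P d′ → d ~ d′ → col d ≢ col d′

  Colourable : (Dart → Set) → Set
  Colourable P = ∃ (Proper P)

  restrict : ∀ {P Q : Dart → Set} {col} → (∀ {d} → Q d → P d) → Proper P col → Proper Q col
  restrict Q⊆P (proper l d) = proper (l ∘ Q⊆P) λ p q → d (Q⊆P p) (Q⊆P q)

  _[_≔_] : (Dart → ℕ) → Dart → ℕ → Dart → ℕ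
  (col [ d ≔ x ]) d′ with d′ ≟ᵈ d
  ... | yes _ = x
  ... | no _  = col d′

  update-same : ∀ col d {x} → (col [ d ≔ x ]) d ≡ x
  update-same col d with d ≟ᵈ d
  ... | yes _ = refl
  ... | no d≢d = contradiction refl d≢d

  update-other : ∀ col {d d′ x} → d′ ≢ d → (col [ d ≔ x ]) d′ ≡ col d′
  update-other col {d} {d′} d′≢d with d′ ≟ᵈ d
  ... | yes eq = contradiction eq d′≢d
  ... | no _ = refl

  _▸_ : (Dart → Set) → Dart → Dart → Set
  (P ▸ d) d′ = d′ ≡ d ⊎ P d′

  ~-sym : ∀ {d d′} → d ~ d′ → d′ ~ d
  ~-sym (d≢ , inj₁ p) = ≢-sym d≢ , inj₁ (sym p)
  ~-sym (d≢ , inj₂ (inj₁ p)) = ≢-sym d≢ , inj₂ (inj₂ (sym p))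
  ~-sym (d≢ , inj₂ (inj₂ p)) = ≢-sym d≢ , inj₂ (inj₁ (sym p))

  Fits : (Dart → Set) → (Dart → ℕ) → Dart → ℕ → Set
  Fits P col d x = x ∈ L d × (∀ {d′} → P d′ → d ~ d′ → x ≢ col d′)

  extend : ∀ {P col d x} → Proper P col → Fits P col d x → Proper (P ▸ d) (col [ d ≔ x ])
  extend {P} {col} {d} {x} (proper listed distinct) (x∈ , avoids) = proper listed′ distinct′
    where
    listed′ : ∀ {k} → (P ▸ d) k → (col [ d ≔ x ]) k ∈ L k
    listed′ {k} p with k ≟ᵈ d | p
    ... | yes refl | _ = x∈
    ... | no k≢d | inj₁ eq = contradiction eq k≢d
    ... | no _ | inj₂ Pk = listed Pk
    distinct′ : ∀ {k k′} → (P ▸ d) k → (P ▸ d) k′ → k ~ k′ → (col [ d ≔ x ]) k ≢ (col [ d ≔ x ]) k′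
    distinct′ {k} {k′} p p′ k~k′ with k ≟ᵈ d | k′ ≟ᵈ d | p | p′
    ... | yes refl | yes refl | _ | _ = contradiction refl (proj₁ k~k′)
    ... | yes refl | no k′≢d | _ | inj₁ eq = contradiction eq k′≢d
    ... | yes refl | no _ | _ | inj₂ Pk′ = avoids Pk′ k~k′
    ... | no k≢d | _ | inj₁ eq | _ = contradiction eq k≢d
    ... | no _ | yes refl | inj₂ Pk | _ = ≢-sym (avoids Pk (~-sym k~k′))
    ... | no _ | no k′≢d | inj₂ _ | inj₁ eq = contradiction eq k′≢d
    ... | no _ | no _ | inj₂ Pk | inj₂ Pk′ = distinct Pk Pk′ k~k′

  fits : ∀ {P col d x} N → x ∈ L d ∖ map col N → (∀ {d′} → P d′ → d ~ d′ → d′ ∈ N) → Fits P col d x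
  fits {col = col} {d} N x∈ cover with ∈-∖⁻ {xs = L d} (map col N) x∈
  ... | x∈L , x∉ = x∈L , λ { Pd′ d~d′ refl → x∉ (∈-map⁺ col (cover Pd′ d~d′)) }

  -- `N` covers the coloured conflicts of `d`, and `F` holds colours to avoid for other reasons;
  -- together they have at most five entries. The continuation lets several steps be chained, each
  -- with its new colour in scope.
  greedy : ∀ {P col} → Proper P col → ∀ d N F → {_ : True (length (map col N ++ F) <? 6)} →
           (∀ {d′} → P d′ → d ~ d′ → d′ ∈ N) → {R : Set} →
           (∀ {x} → All (x ≢_) F → Proper (P ▸ d) (col [ d ≔ x ]) → R) → R
  greedy {col = col} ok d N F {lt} cover continue
    with x , x∈ , x≢ ← choose (palette d) (map col N ++ F) {lt}
    = continue (All.tabulate λ y∈ → All.lookup x≢ (∈-++⁺ʳ (map col N) y∈))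
        (extend ok (x∈ , λ Pd′ d~d′ → All.lookup x≢ (∈-++⁺ˡ (∈-map⁺ col (cover Pd′ d~d′)))))

  _▸*_ : (Dart → Set) → List (Dart × ℕ) → Dart → Set
  P ▸* [] = P
  P ▸* ((d , _) ∷ ps) = P ▸* ps ▸ d

  assign : (Dart → ℕ) → List (Dart × ℕ) → Dart → ℕ
  assign col [] = col
  assign col ((d , x) ∷ ps) = assign col ps [ d ≔ x ]

  assigned : ∀ {P col} ps {d} → (P ▸* ps) d →
             (d , assign col ps d) ∈ ps ⊎ (P d × assign col ps d ≡ col d)
  assigned [] Pd = inj₂ (Pd , refl)
  assigned ((k , x) ∷ ps) {d} p with d ≟ᵈ k | p
  ... | yes refl | _ = inj₁ (here refl)
  ... | no d≢k | inj₁ eq = contradiction eq d≢k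
  ... | no _ | inj₂ p′ with assigned ps p′
  ...   | inj₁ d∈ = inj₁ (there d∈)
  ...   | inj₂ old = inj₂ old

  Compatible : Dart × ℕ → Dart × ℕ → Set
  Compatible (d , x) (d′ , x′) = d ~ d′ → x ≢ x′

  -- `Fits` compares each new dart with the old colouring only; conflicts among the new darts are
  -- left to `Compatible`.
  extend* : ∀ {P col} → Proper P col → ∀ {ps} → All (λ (d , x) → Fits P col d x) ps →
            AllPairs Compatible ps → Proper (P ▸* ps) (assign col ps)
  extend* ok [] [] = ok
  extend* {P} {col} ok {(d , x) ∷ ps} ((x∈ , avoids) ∷ fs) (cs ∷ css) =
    extend (extend* ok fs css) (x∈ , avoids′)
    where
    avoids′ : ∀ {d′} → (P ▸* ps) d′ → d ~ d′ → x ≢ assign col ps d′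
    avoids′ p d~d′ with assigned ps p
    ... | inj₁ d′∈ = All.lookup cs d′∈ d~d′
    ... | inj₂ (Pd′ , eq) = λ x≡ → avoids Pd′ d~d′ (trans x≡ eq)

  keys⊆ : ∀ {P} ps {d} → d ∈ map proj₁ ps ⊎ P d → (P ▸* ps) d
  keys⊆ [] (inj₂ Pd) = Pd
  keys⊆ (_ ∷ ps) (inj₁ (here eq)) = inj₁ eq
  keys⊆ (_ ∷ ps) (inj₁ (there d∈)) = inj₂ (keys⊆ ps (inj₁ d∈))
  keys⊆ (_ ∷ ps) (inj₂ Pd) = inj₂ (keys⊆ ps (inj₂ Pd))

  -- Removing a vertex, and the conflicts of the darts at it.

  abstract
    _⊖_ : List Vertex → Vertex → List Vertex
    S ⊖ b = filter (λ v → ¬? (v ≟ᵛ b)) S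

    ∈-⊖⁺ : ∀ {S b v} → v ∈ S → v ≢ b → v ∈ S ⊖ b
    ∈-⊖⁺ {b = b} = ∈-filter⁺ (λ v → ¬? (v ≟ᵛ b))

    ⊖-avoids : ∀ {S b v} → v ∈ S ⊖ b → v ≢ b
    ⊖-avoids {S} {b} v∈ = proj₂ (∈-filter⁻ (λ v → ¬? (v ≟ᵛ b)) {xs = S} v∈)

    length-⊖-≤ : ∀ S b → length (S ⊖ b) ≤ length S
    length-⊖-≤ S b = length-filter (λ v → ¬? (v ≟ᵛ b)) S

    length-⊖-< : ∀ {S b} → b ∈ S → length (S ⊖ b) < length S
    length-⊖-< {S} {b} b∈ = filter-notAll (λ v → ¬? (v ≟ᵛ b)) S (lose b∈ λ b≢b → b≢b refl)

  record Inside (S : List Vertex) (d : Dart) : Set where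
    constructor inside
    field
      base∈ : base d ∈ S
      rev∈  : base (rev d) ∈ S

  inside-rev : ∀ {S d} → Inside S d → Inside S (rev d)
  inside-rev {S} {d} (inside p q) = inside q (subst (λ x → base x ∈ S) (sym (rev-involutive d)) p)

  inside-split : ∀ {S} b {d} → Inside S d → base d ≡ b ⊎ base (rev d) ≡ b ⊎ Inside (S ⊖ b) d
  inside-split b {d} (inside p q) with base d ≟ᵛ b | base (rev d) ≟ᵛ b
  ... | yes eq | _ = inj₁ eq
  ... | no _ | yes eq = inj₂ (inj₁ eq)
  ... | no n | no n′ = inj₂ (inj₂ (inside (∈-⊖⁺ p n) (∈-⊖⁺ q n′)))

  rev-≡ : ∀ {d d′} → rev d ≡ d′ → d ≡ rev d′
  rev-≡ {d} refl = sym (rev-involutive d)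

  -- Besides darts at `v`, a dart `e` towards `v` conflicts only with darts at its own base or
  -- leading there: its siblings and their reversals. Two siblings give four conflicts, which leaves
  -- two of six colours.
  conflicts-inward : ∀ {e d v} ks → base (rev e) ≡ v → base d ≢ v →
                     (base d ≡ base e → d ∈ e ∷ ks) → (base (rev d) ≡ base e → rev d ∈ e ∷ ks) →
                     e ~ d → d ∈ ks ++ map rev ks
  conflicts-inward ks refl d≢v here? rev? (e≢d , inj₁ p) with here? (sym p)
  ... | here eq = contradiction (sym eq) e≢d
  ... | there d∈ = ∈-++⁺ˡ d∈
  conflicts-inward ks refl d≢v here? rev? (e≢d , inj₂ (inj₁ p)) = contradiction (sym p) d≢v
  conflicts-inward {d = d} ks refl d≢v here? rev? (e≢d , inj₂ (inj₂ p)) with rev? (sym p)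
  ... | here eq = contradiction (cong base (rev-≡ eq)) d≢v
  ... | there d∈ = ∈-++⁺ʳ ks (subst (_∈ map rev ks) (rev-involutive d) (∈-map⁺ rev d∈))

  -- Away from `v`, a dart out of `v` conflicts only with darts based at the vertex it leads to, and
  -- `rev d` is excluded because it returns to `v`. Two siblings leave four of six colours.
  conflicts-outward : ∀ {d d′ v} ks → base d ≡ v → base d′ ≢ v → base (rev d′) ≢ v →
                      (base d′ ≡ base (rev d) → d′ ∈ rev d ∷ ks) → d ~ d′ → d′ ∈ ks
  conflicts-outward ks refl n n′ here? (_ , inj₁ p) = contradiction (sym p) n
  conflicts-outward ks refl n n′ here? (_ , inj₂ (inj₁ p)) with here? (sym p)
  ... | here refl = contradiction (cong base (rev-involutive _)) n′
  ... | there d∈ = d∈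
  conflicts-outward ks refl n n′ here? (_ , inj₂ (inj₂ p)) = contradiction (sym p) n′

  sibs : Dart → List Dart
  sibs d = sib₁ d ∷ sib₂ d ∷ []

  inward : Dart → List Dart
  inward e = sibs e ++ map rev (sibs e)

  covers-in : ∀ {S b} d → base d ≡ b → ∀ {x} → Inside (S ⊖ b) x → rev d ~ x → x ∈ inward (rev d)
  covers-in d d∈b (inside p q) = conflicts-inward (sibs (rev d))
    (trans (cong base (rev-involutive d)) d∈b) (⊖-avoids p) (siblings (rev d)) (siblings (rev d))

  covers-out : ∀ {S b} d → base d ≡ b → ∀ {x} → Inside (S ⊖ b) x → d ~ x → x ∈ sibs (rev d)
  covers-out d d∈b (inside p q) =
    conflicts-outward (sibs (rev d)) d∈b (⊖-avoids p) (⊖-avoids q) (siblings (rev d))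

  -- In the order chosen, the darts meet at most 4, 5, 4 and 5 coloured conflicts. The darts `d` and
  -- `f` may coincide; the same pair of darts is then coloured twice.
  extend-two : ∀ {S b} d f → base d ≡ b → base f ≡ b → (∀ {x} → base x ≡ b → x ≡ d ⊎ x ≡ f) →
               Colourable (Inside (S ⊖ b)) → Colourable (Inside S)
  extend-two {S} {b} d f d∈b f∈b at (col , ok) =
    greedy ok (rev d) (inward (rev d)) [] (covers-in d d∈b) λ _ ok₁ →
    greedy ok₁ (rev f) (rev d ∷ inward (rev f)) []
      (λ { (inj₁ refl) _ → here refl ; (inj₂ p) c → there (covers-in f f∈b p c) }) λ _ ok₂ →
    greedy ok₂ d (rev f ∷ rev d ∷ sibs (rev d)) []
      (λ { (inj₁ refl) _ → here refl ; (inj₂ (inj₁ refl)) _ → there (here refl)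
         ; (inj₂ (inj₂ p)) c → there (there (covers-out d d∈b p c)) }) λ _ ok₃ →
    greedy ok₃ f (d ∷ rev f ∷ rev d ∷ sibs (rev f)) []
      (λ { (inj₁ refl) _ → here refl ; (inj₂ (inj₁ refl)) _ → there (here refl)
         ; (inj₂ (inj₂ (inj₁ refl))) _ → there (there (here refl))
         ; (inj₂ (inj₂ (inj₂ p))) c → there (there (there (covers-out f f∈b p c))) }) λ _ ok₄ →
    _ , restrict all ok₄
    where
    all : ∀ {x} → Inside S x → (Inside (S ⊖ b) ▸ rev d ▸ rev f ▸ d ▸ f) x
    all x-in with inside-split b x-in
    ... | inj₂ (inj₂ p) = inj₂ (inj₂ (inj₂ (inj₂ p)))
    ... | inj₁ x∈b with at x∈b
    ...   | inj₁ eq = inj₂ (inj₁ eq)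
    ...   | inj₂ eq = inj₁ eq
    all x-in | inj₂ (inj₁ rx∈b) with at rx∈b
    ...   | inj₁ eq = inj₂ (inj₂ (inj₂ (inj₁ (rev-≡ eq))))
    ...   | inj₂ eq = inj₂ (inj₂ (inj₁ (rev-≡ eq)))

  -- Extending a colouring to the six darts at a cubic vertex.

  record Cubic (b : Vertex) (d₁ d₂ d₃ : Dart) : Set where
    constructor cubic
    field
      base₁ : base d₁ ≡ b
      base₂ : base d₂ ≡ b
      base₃ : base d₃ ≡ b
      d₁≢d₂ : d₁ ≢ d₂
      d₁≢d₃ : d₁ ≢ d₃
      d₂≢d₃ : d₂ ≢ d₃
      at    : ∀ {x} → base x ≡ b → x ∈ d₁ ∷ d₂ ∷ d₃ ∷ []

  inside-star : ∀ {S b d₁ d₂ d₃} → Cubic b d₁ d₂ d₃ → ∀ {x} → Inside S x →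
                x ∈ d₁ ∷ d₂ ∷ d₃ ∷ rev d₁ ∷ rev d₂ ∷ rev d₃ ∷ [] ⊎ Inside (S ⊖ b) x
  inside-star {b = b} {d₁} {d₂} {d₃} cub x-in with inside-split b x-in
  ... | inj₁ x∈b = inj₁ (∈-++⁺ˡ (Cubic.at cub x∈b))
  ... | inj₂ (inj₂ p) = inj₂ p
  ... | inj₂ (inj₁ rx∈b) = inj₁ (∈-++⁺ʳ (d₁ ∷ d₂ ∷ d₃ ∷ [])
          (subst (_∈ map rev (d₁ ∷ d₂ ∷ d₃ ∷ [])) (rev-involutive _) (∈-map⁺ rev (Cubic.at cub rx∈b))))

  -- A parameter `ks` replaces `sibs e` so that shorter covers, which leave larger lists, can be
  -- used at parallel edges.
  Covers : List Vertex → Dart → List Dart → Set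
  Covers T e ks = ∀ {x} → Inside T x → base x ≡ base e → x ∈ ks

  covers-sibs : ∀ {S b} d → base d ≡ b → Covers (S ⊖ b) (rev d) (sibs (rev d))
  covers-sibs d refl x-in x∈e with siblings (rev d) x∈e
  ... | here refl = contradiction (cong base (rev-involutive d)) (⊖-avoids (Inside.rev∈ x-in))
  ... | there x∈ = x∈

  outs : (Dart → ℕ) → Dart → List Dart → List ℕ
  outs col d ks = L d ∖ map col ks

  ins : (Dart → ℕ) → Dart → List Dart → List ℕ
  ins col d ks = L (rev d) ∖ map col (ks ++ map rev ks)

  module _ {S : List Vertex} {b : Vertex} {d₁ d₂ d₃ : Dart} (cub : Cubic b d₁ d₂ d₃)
           {col : Dart → ℕ} (ok : Proper (Inside (S ⊖ b)) col) where
    open Cubic cub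

    private
      fits-out : ∀ {d x ks} → base d ≡ b → Covers (S ⊖ b) (rev d) ks → x ∈ outs col d ks →
                 Fits (Inside (S ⊖ b)) col d x
      fits-out {ks = ks} d∈b cov x∈ = fits ks x∈ λ y-in →
        conflicts-outward ks d∈b (⊖-avoids (Inside.base∈ y-in)) (⊖-avoids (Inside.rev∈ y-in)) (there ∘ cov y-in)

      fits-in : ∀ {d x ks} → base d ≡ b → Covers (S ⊖ b) (rev d) ks → x ∈ ins col d ks →
                Fits (Inside (S ⊖ b)) col (rev d) x
      fits-in {d} {ks = ks} d∈b cov x∈ = fits (ks ++ map rev ks) x∈ λ y-in →
        conflicts-inward ks (trans (cong base (rev-involutive d)) d∈b) (⊖-avoids (Inside.base∈ y-in))
          (there ∘ cov y-in) (there ∘ cov (inside-rev y-in))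

      -- Inward darts lead to `b`, and neither is based there, so the only possible conflict between
      -- them is a common base.
      parallel : ∀ {d d′} → base d ≡ b → base d′ ≡ b → rev d ~ rev d′ → base (rev d) ≡ base (rev d′)
      parallel _ _ (_ , inj₁ p) = p
      parallel {d} {d′} refl d′∈b (_ , inj₂ (inj₁ p)) = contradiction
        (trans (sym p) (trans (cong base (rev-involutive d)) (sym d′∈b))) (base-rev d′)
      parallel {d} {d′} refl d′∈b (_ , inj₂ (inj₂ p)) = contradiction
        (trans p (trans (cong base (rev-involutive d′)) d′∈b)) (base-rev d)

    -- `StarColours` lets inward darts share a colour. Those with a common base must not, and for
    -- them disjoint lists are demanded.
    extend-star : ∀ {ks₁ ks₂ ks₃ O₁ O₂ O₃ A₁ A₂ A₃} →
      Covers (S ⊖ b) (rev d₁) ks₁ → Covers (S ⊖ b) (rev d₂) ks₂ → Covers (S ⊖ b) (rev d₃) ks₃ →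
      O₁ ⊆ outs col d₁ ks₁ → O₂ ⊆ outs col d₂ ks₂ → O₃ ⊆ outs col d₃ ks₃ →
      A₁ ⊆ ins col d₁ ks₁ → A₂ ⊆ ins col d₂ ks₂ → A₃ ⊆ ins col d₃ ks₃ →
      (base (rev d₁) ≡ base (rev d₂) → ∀ {x} → x ∈ A₁ → x ∉ A₂) →
      (base (rev d₁) ≡ base (rev d₃) → ∀ {x} → x ∈ A₁ → x ∉ A₃) →
      (base (rev d₂) ≡ base (rev d₃) → ∀ {x} → x ∈ A₂ → x ∉ A₃) →
      StarColours O₁ O₂ O₃ A₁ A₂ A₃ → Colourable (Inside S)
    extend-star c₁ c₂ c₃ O₁⊆ O₂⊆ O₃⊆ A₁⊆ A₂⊆ A₃⊆ A₁₂ A₁₃ A₂₃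
      (star {o₁} {o₂} {o₃} o₁∈ o₂∈ o₃∈ o₁≢o₂ o₁≢o₃ o₂≢o₃
        (a₁ , a₁∈ , a₁≢o₁ ∷ a₁≢o₂ ∷ a₁≢o₃ ∷ [])
        (a₂ , a₂∈ , a₂≢o₁ ∷ a₂≢o₂ ∷ a₂≢o₃ ∷ [])
        (a₃ , a₃∈ , a₃≢o₁ ∷ a₃≢o₂ ∷ a₃≢o₃ ∷ []))
      = assign col ps , restrict (keys⊆ {Inside (S ⊖ b)} ps ∘ inside-star cub) (extend* ok {ps}
          ( fits-out base₁ c₁ (O₁⊆ o₁∈) ∷ fits-out base₂ c₂ (O₂⊆ o₂∈) ∷ fits-out base₃ c₃ (O₃⊆ o₃∈)
          ∷ fits-in base₁ c₁ (A₁⊆ a₁∈) ∷ fits-in base₂ c₂ (A₂⊆ a₂∈) ∷ fits-in base₃ c₃ (A₃⊆ a₃∈) ∷ [])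
          ( ((λ _ → o₁≢o₂) ∷ (λ _ → o₁≢o₃)
              ∷ (λ _ → ≢-sym a₁≢o₁) ∷ (λ _ → ≢-sym a₂≢o₁) ∷ (λ _ → ≢-sym a₃≢o₁) ∷ [])
          ∷ ((λ _ → o₂≢o₃)
              ∷ (λ _ → ≢-sym a₁≢o₂) ∷ (λ _ → ≢-sym a₂≢o₂) ∷ (λ _ → ≢-sym a₃≢o₂) ∷ [])
          ∷ ((λ _ → ≢-sym a₁≢o₃) ∷ (λ _ → ≢-sym a₂≢o₃) ∷ (λ _ → ≢-sym a₃≢o₃) ∷ [])
          ∷ ((λ { c refl → A₁₂ (parallel base₁ base₂ c) a₁∈ a₂∈ })
              ∷ (λ { c refl → A₁₃ (parallel base₁ base₃ c) a₁∈ a₃∈ }) ∷ [])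
          ∷ ((λ { c refl → A₂₃ (parallel base₂ base₃ c) a₂∈ a₃∈ }) ∷ [])
          ∷ [] ∷ []))
      where
      ps = (d₁ , o₁) ∷ (d₂ , o₂) ∷ (d₃ , o₃) ∷ (rev d₁ , a₁) ∷ (rev d₂ , a₂) ∷ (rev d₃ , a₃) ∷ []

  -- Parallel edges.

  rev-≢ : ∀ {d d′} → d ≢ d′ → rev d ≢ rev d′
  rev-≢ d≢d′ eq = d≢d′ (trans (rev-≡ eq) (rev-involutive _))

  third-sibling : ∀ e {e′} → base e′ ≡ base e → e′ ≢ e →
                  ∃ λ g → ∀ {x} → base x ≡ base e → x ∈ e ∷ e′ ∷ g ∷ []
  third-sibling e e′∈ e′≢e with siblings e e′∈
  ... | here eq = contradiction eq e′≢e
  ... | there (here refl) = sib₂ e , siblings e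
  ... | there (there (here refl)) = sib₁ e , λ x∈ → ∈-swap (siblings e x∈)

  greedy-isolated : ∀ {P} ks → length ks ≤ 6 → (∀ {k x} → k ∈ ks → P x → ¬ k ~ x) →
                    Colourable P → Colourable (λ x → x ∈ ks ⊎ P x)
  greedy-isolated [] _ _ (col , ok) = col , restrict (λ { (inj₂ p) → p }) ok
  greedy-isolated (k ∷ ks) lt isolated done
    with col , ok ← greedy-isolated ks (ℕₚ.<⇒≤ lt) (isolated ∘ there) done
    with x , x∈ , x≢ ← palette-choose (palette k) (map col ks)
                         (≤-trans (s≤s (≤-reflexive (length-map col ks))) lt)
    = _ , restrict (λ { (inj₁ (here eq)) → inj₁ eq ; (inj₁ (there p)) → inj₂ (inj₁ p)
                      ; (inj₂ p) → inj₂ (inj₂ p) })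
            (extend ok (x∈ , λ { (inj₁ d∈) _ → All.lookup x≢ (∈-map⁺ col d∈)
                               ; (inj₂ p) c → contradiction c (isolated (here refl) p) }))

  -- Three parallel edges form a component of the multigraph, so their six darts conflict only with
  -- each other, and six colours in each list are enough.
  extend-triple : ∀ {S b d₁ d₂ d₃} → Cubic b d₁ d₂ d₃ →
                  base (rev d₁) ≡ base (rev d₂) → base (rev d₁) ≡ base (rev d₃) →
                  Colourable (Inside (S ⊖ b)) → Colourable (Inside S)
  extend-triple {S} {b} {d₁} {d₂} {d₃} cub e₁≡e₂ e₁≡e₃ done
    with g , at-e ← third-sibling (rev d₁) (sym e₁≡e₂) (rev-≢ (≢-sym (Cubic.d₁≢d₂ cub)))
    with at-e (sym e₁≡e₃)
  ... | here eq = contradiction eq (rev-≢ (≢-sym (Cubic.d₁≢d₃ cub)))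
  ... | there (here eq) = contradiction eq (rev-≢ (≢-sym (Cubic.d₂≢d₃ cub)))
  ... | there (there (here refl)) =
    let col , ok = greedy-isolated ks ≤-refl isolated done in col , restrict (inside-star cub) ok
    where
    open Cubic cub
    ks = d₁ ∷ d₂ ∷ d₃ ∷ rev d₁ ∷ rev d₂ ∷ rev d₃ ∷ []
    Near : Vertex → Set
    Near v = v ≡ b ⊎ v ≡ base (rev d₁)
    turn : ∀ {d} → base d ≡ b → base (rev (rev d)) ≡ b
    turn d∈b = trans (cong base (rev-involutive _)) d∈b
    near : ∀ {k} → k ∈ ks → Near (base k) × Near (base (rev k))
    near (here refl) = inj₁ base₁ , inj₂ refl
    near (there (here refl)) = inj₁ base₂ , inj₂ (sym e₁≡e₂)
    near (there (there (here refl))) = inj₁ base₃ , inj₂ (sym e₁≡e₃)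
    near (there (there (there (here refl)))) = inj₂ refl , inj₁ (turn base₁)
    near (there (there (there (there (here refl))))) = inj₂ (sym e₁≡e₂) , inj₁ (turn base₂)
    near (there (there (there (there (there (here refl)))))) = inj₂ (sym e₁≡e₃) , inj₁ (turn base₃)
    far : ∀ {x} → Inside (S ⊖ b) x → ¬ Near (base x)
    far (inside p _) (inj₁ eq) = ⊖-avoids p eq
    far (inside _ q) (inj₂ eq) with at-e eq
    ... | here refl = ⊖-avoids q (turn base₁)
    ... | there (here refl) = ⊖-avoids q (turn base₂)
    ... | there (there (here refl)) = ⊖-avoids q (turn base₃)
    isolated : ∀ {k x} → k ∈ ks → Inside (S ⊖ b) x → ¬ k ~ x
    isolated k∈ x-in (_ , inj₁ eq) = far x-in (subst Near eq (proj₁ (near k∈)))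
    isolated k∈ x-in (_ , inj₂ (inj₁ eq)) = far x-in (subst Near eq (proj₂ (near k∈)))
    isolated k∈ x-in (_ , inj₂ (inj₂ eq)) = far (inside-rev x-in) (subst Near eq (proj₁ (near k∈)))

  -- Once `b` is removed, at most the dart `g` remains at the common far end of `d₁` and `d₃`. This
  -- leaves five colours outward and four inward on the parallel edges.
  extend-double : ∀ {S b d₁ d₂ d₃} → Cubic b d₁ d₂ d₃ →
                  base (rev d₁) ≡ base (rev d₃) → base (rev d₁) ≢ base (rev d₂) →
                  Colourable (Inside (S ⊖ b)) → Colourable (Inside S)
  extend-double {S} {b} {d₁} {d₂} {d₃} cub e₁≡e₃ e₁≢e₂ (col , ok)
    with g , at-e ← third-sibling (rev d₁) (sym e₁≡e₃) (rev-≢ (≢-sym (Cubic.d₁≢d₃ cub)))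
    -- Five colours at `d₁` against four kept at `d₂` provide `z`.
    with z , z∈ , z≢ ← palette-choose (palette-∖ (palette d₁) (map col (g ∷ [])))
                         (take 4 (outs col d₂ (sibs (rev d₂)))) (s≤s (length-take-≤ 4 (outs col d₂ (sibs (rev d₂)))))
    -- The colours `u` and `v` are reserved for `rev d₁` and withheld from `rev d₃`, whose list
    -- keeps two; the two lists are thus disjoint.
    with u , u∈ , [] ← choose (palette-∖ (palette (rev d₁)) (map col (g ∷ rev g ∷ []))) []
    with v , v∈ , v≢u ∷ [] ← choose (palette-∖ (palette (rev d₁)) (map col (g ∷ rev g ∷ []))) (u ∷ [])
    = extend-star cub ok at-e₁ (covers-sibs d₂ base₂) (λ x-in x∈ → at-e₁ x-in (trans x∈ (sym e₁≡e₃)))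
        id (take-⊆ 4) id
        (λ { (here refl) → u∈ ; (there (here refl)) → v∈ }) id (proj₁ ∘ ∈-∖⁻ (u ∷ v ∷ []))
        (λ eq → contradiction eq e₁≢e₂)
        (λ _ x∈ x∈′ → proj₂ (∈-∖⁻ {xs = ins col d₃ (g ∷ [])} (u ∷ v ∷ []) x∈′) x∈)
        (λ eq → contradiction (trans e₁≡e₃ (sym eq)) e₁≢e₂)
        (star-colours (weaken 4 (palette-∖ (palette d₁) (map col (g ∷ []))))
          (palette-take (palette-∖ (palette d₂) (map col (sibs (rev d₂)))))
          (weaken 4 (palette-∖ (palette d₃) (map col (g ∷ []))))
          z∈ (λ z∈′ → All.lookup z≢ z∈′ refl)
          (((≢-sym v≢u ∷ []) ∷ [] ∷ []) , ≤-refl)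
          (palette-∖ (palette (rev d₂)) (map col (inward (rev d₂))))
          (palette-∖ (palette-∖ (palette (rev d₃)) (map col (g ∷ rev g ∷ []))) (u ∷ v ∷ [])))
    where
    open Cubic cub
    at-e₁ : Covers (S ⊖ b) (rev d₁) (g ∷ [])
    at-e₁ (inside _ q) x∈ with at-e x∈
    ... | here refl = contradiction (trans (cong base (rev-involutive d₁)) base₁) (⊖-avoids q)
    ... | there (here refl) = contradiction (trans (cong base (rev-involutive d₃)) base₃) (⊖-avoids q)
    ... | there (there x∈g) = x∈g

  -- Two adjacent cubic vertices `b` and `c`.

  module Bridge {S : List Vertex} {b : Vertex} {d d₁ d₂ p₁ p₂ : Dart}
                (cub : Cubic b d d₁ d₂)
                (cub′ : Cubic (base (rev d)) (rev d) p₁ p₂)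
                (e₁≢e : base (rev d₁) ≢ base (rev d)) (e₂≢e : base (rev d₂) ≢ base (rev d))
                (e₁≢e₂ : base (rev d₁) ≢ base (rev d₂))
                (e₁≢q₁ : base (rev d₁) ≢ base (rev p₁)) where
    open Cubic cub
    open Cubic cub′ using () renaming (base₂ to p₁∈c; base₃ to p₂∈c; d₂≢d₃ to p₁≢p₂; at to at-c)

    private
      c : Vertex
      c = base (rev d)

      q₁ q₂ e₁ : Dart
      q₁ = rev p₁
      q₂ = rev p₂
      e₁ = rev d₁

      turn : ∀ {k v} → base k ≡ v → base (rev (rev k)) ≡ v
      turn k∈v = trans (cong base (rev-involutive _)) k∈v

      off-c : ∀ {p} → base p ≡ c → base (rev p) ≢ c
      off-c p∈c eq = base-rev _ (trans eq (sym p∈c))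

      covers-c : Covers (S ⊖ b) (rev d) (p₁ ∷ p₂ ∷ [])
      covers-c (inside _ q) x∈ with at-c x∈
      ... | here refl = contradiction (turn base₁) (⊖-avoids q)
      ... | there x∈′ = x∈′

      -- The colour `z` is still available at `d` but absent from the list kept at `d₁`, as
      -- `star-colours` requires.
      finish : ∀ {col O z} → Proper (Inside (S ⊖ b)) col → Palette 4 O → O ⊆ outs col d₁ (sibs e₁) →
               z ∈ L d → z ∉ O → z ≢ col p₁ → z ≢ col p₂ → Colourable (Inside S)
      finish {col} {O} {z} ok O-pal O⊆ z∈ z∉O z≢₁ z≢₂ =
        extend-star cub ok covers-c (covers-sibs d₁ base₂) (covers-sibs d₂ base₃)
          id O⊆ id id id id
          (λ eq → contradiction (sym eq) e₁≢e) (λ eq → contradiction (sym eq) e₂≢e)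
          (λ eq → contradiction eq e₁≢e₂)
          (star-colours (palette-∖ (palette d) (map col (p₁ ∷ p₂ ∷ []))) O-pal
            (palette-∖ (palette d₂) (map col (sibs (rev d₂))))
            (∈-∖⁺ (map col (p₁ ∷ p₂ ∷ [])) z∈ λ { (here eq) → z≢₁ eq ; (there (here eq)) → z≢₂ eq }) z∉O
            (palette-∖ (palette (rev d)) (map col (p₁ ∷ p₂ ∷ q₁ ∷ q₂ ∷ [])))
            (palette-∖ (palette e₁) (map col (inward e₁)))
            (palette-∖ (palette (rev d₂)) (map col (inward (rev d₂)))))

      near-c : ∀ {x} → Inside (S ⊖ b) x → (Inside (S ⊖ b ⊖ c) ▸ q₂ ▸ p₁ ▸ q₁ ▸ p₂) x
      near-c x-in with inside-split c x-in
      ... | inj₂ (inj₂ p) = inj₂ (inj₂ (inj₂ (inj₂ p)))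
      ... | inj₁ x∈c with covers-c x-in x∈c
      ...   | here eq = inj₂ (inj₂ (inj₁ eq))
      ...   | there (here eq) = inj₁ eq
      near-c x-in | inj₂ (inj₁ rx∈c) with covers-c (inside-rev x-in) rx∈c
      ...   | here eq = inj₂ (inj₁ (rev-≡ eq))
      ...   | there (here eq) = inj₂ (inj₂ (inj₂ (inj₁ (rev-≡ eq))))

      -- The list `O` is fixed under the earlier colouring `col`. It remains usable under `col′`
      -- because the two agree on the siblings of `e₁`.
      conclude : ∀ {col col′ t₁ t₂} → (∀ {f} → f ∈ sibs e₁ → col′ f ≡ col f) →
        let O = take 4 (outs col d₁ (sibs e₁)) in
        t₁ ∈ L d → t₁ ∉ O → t₂ ∈ L d → t₂ ∉ O → t₁ ≢ t₂ → t₁ ≢ col′ p₁ → t₂ ≢ col′ p₁ →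
        Proper (Inside (S ⊖ b ⊖ c) ▸ q₂ ▸ p₁ ▸ q₁ ▸ p₂) col′ → Colourable (Inside S)
      conclude {col} {col′} {t₁} {t₂} same t₁∈ t₁∉ t₂∈ t₂∉ t₁≢t₂ t₁≢p₁ t₂≢p₁ ok = pick (t₁ ℕ.≟ col′ p₂)
        where
        O-pal : Palette 4 (take 4 (outs col d₁ (sibs e₁)))
        O-pal = palette-take (palette-∖ (palette d₁) (map col (sibs e₁)))
        agree : map col (sibs e₁) ≡ map col′ (sibs e₁)
        agree = cong₂ (λ x y → x ∷ y ∷ []) (sym (same (here refl))) (sym (same (there (here refl))))
        O⊆ : take 4 (outs col d₁ (sibs e₁)) ⊆ outs col′ d₁ (sibs e₁)
        O⊆ {x} x∈ = subst (λ xs → x ∈ L d₁ ∖ xs) agree (take-⊆ 4 x∈)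
        pick : Dec (t₁ ≡ col′ p₂) → Colourable (Inside S)
        pick (yes eq) = finish (restrict near-c ok) O-pal O⊆ t₂∈ t₂∉ t₂≢p₁ λ eq′ → t₁≢t₂ (trans eq (sym eq′))
        pick (no neq) = finish (restrict near-c ok) O-pal O⊆ t₁∈ t₁∉ t₁≢p₁ neq

    -- The colours left at d₁ are settled once q₂ is coloured.  Keep four of
    -- them; then L d contains two other colours t₁ and t₂.  As p₁ avoids both
    -- and p₂ takes at most one, the other is left at d but not kept at d₁.
    extend-bridge : Colourable (Inside (S ⊖ b ⊖ c)) → Colourable (Inside S)
    extend-bridge (col , ok) =
      greedy ok q₂ (inward q₂) [] (covers-in p₂ p₂∈c) λ {x₂} _ ok₁ →
      let col₁ = col [ q₂ ≔ x₂ ]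
          O = take 4 (outs col₁ d₁ (sibs e₁))
          O≤4 = length-take-≤ 4 (outs col₁ d₁ (sibs e₁))
          t₁ , t₁∈ , t₁≢ = palette-choose (palette d) O (s≤s (ℕₚ.m≤n⇒m≤1+n O≤4))
          t₂ , t₂∈ , t₂≢ = palette-choose (palette d) (t₁ ∷ O) (s≤s (s≤s O≤4))
      in
      -- Three conflicts and the two reserved colours make five, the most that a list of six allows.
      greedy ok₁ p₁ (q₂ ∷ sibs q₁) (t₁ ∷ t₂ ∷ [])
        (λ { (inj₁ refl) _ → here refl ; (inj₂ p) cf → there (covers-out p₁ p₁∈c p cf) })
        λ { {x} (x≢t₁ ∷ x≢t₂ ∷ []) ok₂ →
      greedy ok₂ q₁ (p₁ ∷ inward q₁) []
        (λ { (inj₁ refl) _ → here refl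
           -- A separate entry for `q₂` would be a sixth. Since `q₂` is not based at `c`, it can
           -- conflict with `q₁` only as a member of `inward q₁`.
           ; (inj₂ (inj₁ refl)) cf → there (conflicts-inward (sibs q₁) (turn p₁∈c) (off-c p₂∈c)
                                             (siblings q₁) (siblings q₁) cf)
           ; (inj₂ (inj₂ p)) cf → there (covers-in p₁ p₁∈c p cf) }) λ {y} _ ok₃ →
      greedy ok₃ p₂ (q₁ ∷ p₁ ∷ q₂ ∷ sibs q₂) []
        (λ { (inj₁ refl) _ → here refl ; (inj₂ (inj₁ refl)) _ → there (here refl)
           ; (inj₂ (inj₂ (inj₁ refl))) _ → there (there (here refl))
           ; (inj₂ (inj₂ (inj₂ p))) cf → there (there (there (covers-out p₂ p₂∈c p cf))) }) λ {y′} _ ok₄ →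
      let at-p₁ : (col₁ [ p₁ ≔ x ] [ q₁ ≔ y ] [ p₂ ≔ y′ ]) p₁ ≡ x
          at-p₁ = trans (update-other (col₁ [ p₁ ≔ x ] [ q₁ ≔ y ]) p₁≢p₂)
                 (trans (update-other (col₁ [ p₁ ≔ x ]) λ eq → off-c p₁∈c (trans (cong base (sym eq)) p₁∈c))
                        (update-same col₁ p₁))
      in
      conclude (same col₁) t₁∈ (∉-O t₁≢) t₂∈ (∉-O (All.tail t₂≢)) (≢-sym (All.head t₂≢))
        (λ eq → x≢t₁ (sym (trans eq at-p₁))) (λ eq → x≢t₂ (sym (trans eq at-p₁))) ok₄ }
      where
      ∉-O : ∀ {t : ℕ} {O} → All (t ≢_) O → t ∉ O
      ∉-O t≢ t∈ = All.lookup t≢ t∈ refl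
      base-sibs : ∀ {f} → f ∈ sibs e₁ → base f ≡ base e₁
      base-sibs (here refl) = base-sib₁ e₁
      base-sibs (there (here refl)) = base-sib₂ e₁
      -- The siblings of `e₁` are not based at `c`, unlike `p₁` and `p₂`, nor at the base of `q₁`.
      -- Only `q₂` can be one of them, which is why it is coloured first.
      same : ∀ col {x y y′ f} → f ∈ sibs e₁ → (col [ p₁ ≔ x ] [ q₁ ≔ y ] [ p₂ ≔ y′ ]) f ≡ col f
      same col {x} {y} f∈ = trans (update-other (col [ p₁ ≔ x ] [ q₁ ≔ y ]) (apart p₂∈c e₁≢e))
                     (trans (update-other (col [ p₁ ≔ x ]) (apart refl e₁≢q₁))
                            (update-other col (apart p₁∈c e₁≢e)))
        where
        apart : ∀ {k v} → base k ≡ v → base e₁ ≢ v → _ ≢ k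
        apart k∈v e₁≢v refl = e₁≢v (trans (sym (base-sibs f∈)) k∈v)

  -- The induction on the set of vertices.

  cubic? : ∀ d → Cubic (base d) d (sib₁ d) (sib₂ d)
               ⊎ (∃ λ f → base f ≡ base d × ∀ {x} → base x ≡ base d → x ≡ d ⊎ x ≡ f)
  cubic? d with d ≟ᵈ sib₁ d | d ≟ᵈ sib₂ d | sib₁ d ≟ᵈ sib₂ d
  ... | no d≢f | no d≢g | no f≢g =
    inj₁ (cubic refl (base-sib₁ d) (base-sib₂ d) d≢f d≢g f≢g (siblings d))
  ... | yes d≡f | _ | _ = inj₂ (sib₂ d , base-sib₂ d , two ∘ siblings d)
    where
    two : ∀ {x} → x ∈ d ∷ sib₁ d ∷ sib₂ d ∷ [] → x ≡ d ⊎ x ≡ sib₂ d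
    two (here eq) = inj₁ eq
    two (there (here eq)) = inj₁ (trans eq (sym d≡f))
    two (there (there (here eq))) = inj₂ eq
  ... | no _ | yes d≡g | _ = inj₂ (sib₁ d , base-sib₁ d , two ∘ siblings d)
    where
    two : ∀ {x} → x ∈ d ∷ sib₁ d ∷ sib₂ d ∷ [] → x ≡ d ⊎ x ≡ sib₁ d
    two (here eq) = inj₁ eq
    two (there (here eq)) = inj₂ eq
    two (there (there (here eq))) = inj₁ (trans eq (sym d≡g))
  ... | no _ | no _ | yes f≡g = inj₂ (sib₁ d , base-sib₁ d , two ∘ siblings d)
    where
    two : ∀ {x} → x ∈ d ∷ sib₁ d ∷ sib₂ d ∷ [] → x ≡ d ⊎ x ≡ sib₁ d
    two (here eq) = inj₁ eq
    two (there (here eq)) = inj₂ eq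
    two (there (there (here eq))) = inj₂ (trans eq (sym f≡g))

  cycle : ∀ {b d₁ d₂ d₃} → Cubic b d₁ d₂ d₃ → Cubic b d₂ d₃ d₁
  cycle (cubic b₁ b₂ b₃ n₁₂ n₁₃ n₂₃ at) =
    cubic b₂ b₃ b₁ n₂₃ (≢-sym n₁₂) (≢-sym n₁₃) λ x∈ → ∈-cycle (at x∈)

  flip : ∀ {b d₁ d₂ d₃} → Cubic b d₁ d₂ d₃ → Cubic b d₁ d₃ d₂
  flip (cubic b₁ b₂ b₃ n₁₂ n₁₃ n₂₃ at) =
    cubic b₁ b₃ b₂ n₁₃ n₁₂ (≢-sym n₂₃) λ x∈ → ∈-swap (at x∈)

  inside? : ∀ S → Decidable (Inside S)
  inside? S d = map′ (λ (p , q) → inside p q) (λ (inside p q) → p , q)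
                     ((base d ∈ᵛ? S) ×-dec (base (rev d) ∈ᵛ? S))
    where open import Data.List.Membership.DecPropositional _≟ᵛ_ renaming (_∈?_ to _∈ᵛ?_)

  colour-inside : ∀ n S → length S ≤ n → Colourable (Inside S)
  colour-inside n S S≤n with search (inside? S)
  -- Without a dart inside `S` nothing is constrained, and 0 is an arbitrary value.
  ... | no none = (λ _ → 0) , proper (λ p → contradiction (_ , p) none)
                                     (λ p → contradiction (_ , p) none)
  colour-inside ℕ.zero (_ ∷ _) () | yes _
  colour-inside (suc n) S S≤n | yes (d , inside d∈S e∈S) = at-b (cubic? d)
    where
    b = base d
    e = rev d

    smaller : ∀ {v} → v ∈ S → Colourable (Inside (S ⊖ v))
    smaller {v} v∈ = colour-inside n (S ⊖ v) (ℕ.s≤s⁻¹ (≤-trans (length-⊖-< v∈) S≤n))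

    smaller₂ : Colourable (Inside (S ⊖ b ⊖ base e))
    smaller₂ = colour-inside n (S ⊖ b ⊖ base e)
      (≤-trans (length-⊖-≤ (S ⊖ b) (base e)) (ℕ.s≤s⁻¹ (≤-trans (length-⊖-< d∈S) S≤n)))

    at-c : ∀ {d₁ d₂} → Cubic b d d₁ d₂ → base (rev d₁) ≢ base e → base (rev d₂) ≢ base e →
           base (rev d₁) ≢ base (rev d₂) → Colourable (Inside S)
    at-c {d₁} cub e₁≢e e₂≢e e₁≢e₂ with cubic? e
    ... | inj₂ (f , f∈ , two) = extend-two e f refl f∈ two (smaller e∈S)
    ... | inj₁ cub′ with base (rev d₁) ≟ᵛ base (rev (sib₁ e))
    ...   | no e₁≢q₁ = Bridge.extend-bridge cub cub′ e₁≢e e₂≢e e₁≢e₂ e₁≢q₁ smaller₂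
    -- As `d₁` and `d₂` lead to different vertices, `q₁` cannot be based at both; exchanging them
    -- secures the last hypothesis of the bridge.
    ...   | yes e₁≡q₁ = Bridge.extend-bridge (flip cub) cub′ e₂≢e e₁≢e (≢-sym e₁≢e₂)
                          (λ eq → e₁≢e₂ (trans e₁≡q₁ (sym eq))) smaller₂

    at-b : _ → Colourable (Inside S)
    at-b (inj₂ (f , f∈ , two)) = extend-two d f refl f∈ two (smaller d∈S)
    at-b (inj₁ cub)
      with base (rev (sib₁ d)) ≟ᵛ base e | base (rev (sib₂ d)) ≟ᵛ base e
         | base (rev (sib₁ d)) ≟ᵛ base (rev (sib₂ d))
    ... | no e₁≢e | no e₂≢e | no e₁≢e₂ = at-c cub e₁≢e e₂≢e e₁≢e₂
    ... | yes e₁≡e | yes e₂≡e | _ = extend-triple cub (sym e₁≡e) (sym e₂≡e) (smaller d∈S)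
    ... | yes e₁≡e | no e₂≢e | _ = extend-double (flip cub) (sym e₁≡e) (≢-sym e₂≢e) (smaller d∈S)
    ... | no e₁≢e | yes e₂≡e | _ = extend-double cub (sym e₂≡e) (≢-sym e₁≢e) (smaller d∈S)
    -- The reordering puts the parallel pair in the first and third places.
    ... | no e₁≢e | no _ | yes e₁≡e₂ = extend-double (flip (cycle cub)) e₁≡e₂ e₁≢e (smaller d∈S)

  colouring : ∃ λ col → (∀ d → col d ∈ L d) × (∀ {d d′} → d ~ d′ → col d ≢ col d′)
  colouring with colour-inside _ vertices ≤-refl
  ... | col , proper listed distinct =
    col , (λ d → listed (everywhere d)) , λ c → distinct (everywhere _) (everywhere _) c
    where
    everywhere : ∀ d → Inside vertices d
    everywhere d = inside (base∈vertices d) (base∈vertices (rev d))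

-- Degrees and searches in a finite graph.

unique-∈-card : ∀ {n} {p : Subset n} {xs} → Unique xs → All (_∈ₛ p) xs → length xs ≤ ∣ p ∣
unique-∈-card [] [] = z≤n
unique-∈-card {p = p} {x ∷ xs} (x∉ ∷ uniq) (x∈ ∷ xs∈) = ≤-trans
  (s≤s (unique-∈-card uniq (All.tabulate λ y∈ →
    x∈p∧x≢y⇒x∈p-y (All.lookup xs∈ y∈) (≢-sym (All.lookup x∉ y∈)))))
  (x∈p⇒∣p-x∣<∣p∣ x∈)

module _ (G : Graph) where

  open Graph G

  adjacent⇒∈neighbours : ∀ {v w} → T (adj v w) → w ∈ₛ neighbours v
  adjacent⇒∈neighbours {v} {w} vw = lookup⇒[]= w (neighbours v)
    (trans (lookup∘tabulate (adj v) w) (Equivalence.to T-≡ vw))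

  degree≤ : ∀ {S k v} → maxDegreeOn S ≤ k → v ∈ₛ S → degree v ≤ k
  degree≤ {S} {k} {v} ≤k v∈ = ≤-trans
    (All.lookup (xs≤max 0 (map degree (filter (_∈ₛ? S) (allFin order))))
      (∈-map⁺ degree (∈-filter⁺ (_∈ₛ? S) (∈-allFin v) v∈))) ≤k

  few-neighbours : ∀ {S k v ws} → maxDegreeOn S ≤ k → v ∈ₛ S → Unique ws → All (T ∘ adj v) ws → length ws ≤ k
  few-neighbours ≤k v∈ uniq vws =
    ≤-trans (unique-∈-card uniq (All.map adjacent⇒∈neighbours vws)) (degree≤ ≤k v∈)

  private
    module E = Edge

  edge-≡ : ∀ {e f : Edge} → E.lo e ≡ E.lo f → E.hi e ≡ E.hi f → e ≡ f
  edge-≡ {edge l h p q} {edge _ _ p′ q′} refl refl =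
    cong₂ (edge l h) (Finₚ.<-irrelevant p p′) (T-irrelevant q q′)

  _≟ᵉ_ : DecidableEquality Edge
  e ≟ᵉ f = map′ (uncurry edge-≡) (λ { refl → refl , refl })
                ((E.lo e Finₚ.≟ E.lo f) ×-dec (E.hi e Finₚ.≟ E.hi f))

  search-edge : {Q : Edge → Set} → Decidable Q → Dec (∃ Q)
  search-edge {Q} Q? = map′ (λ (u , v , p , q , Qe) → edge u v p q , Qe)
                            (λ (edge u v p q , Qe) → u , v , p , q , Qe)
                            (any? λ u → any? λ v → between u v)
    where
    between : ∀ u v → Dec (∃ λ p → ∃ λ q → Q (edge u v p q))
    between u v with u Finₚ.<? v | T? (adj u v)
    ... | no u≮v | _ = no λ (p , _) → u≮v p
    ... | yes _ | no uv∉ = no λ (_ , q , _) → uv∉ q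
    ... | yes p | yes q = map′ (λ Qe → p , q , Qe)
      (λ (p′ , q′ , Qe) → subst Q (edge-≡ refl refl) Qe) (Q? (edge u v p q))

  abstract
    -- The default `e` stands for a failed search, so that a missing opposite edge or sibling is
    -- represented by the edge itself.
    find-or : {Q : Edge → Set} → Decidable Q → Edge → Edge
    find-or Q? e with search-edge Q?
    ... | yes (f , _) = f
    ... | no _ = e

    find-or-spec : ∀ {Q} (Q? : Decidable Q) e → Q (find-or Q? e) ⊎ (find-or Q? e ≡ e × (∀ f → ¬ Q f))
    find-or-spec Q? e with search-edge Q?
    ... | yes (_ , Qf) = inj₁ Qf
    ... | no none = inj₂ (refl , λ f Qf → none (f , Qf))

  -- The edges at the two ends of an edge.

  module Incidences {A B : Subset order} (bip : IsBipartition A B)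
                    (degA : maxDegreeOn A ≤ 2) (degB : maxDegreeOn B ≤ 3) where

    disjoint : ∀ {v} → v ∈ₛ A → ¬ v ∈ₛ B
    disjoint {v} v∈A v∈B = x∈p⇒x∉∁p v∈A (subst (v ∈ₛ_) (proj₁ bip) v∈B)

    -- Edges are stored in increasing order of their ends, so which end lies in `B` has to be
    -- recovered.
    record Ends (e : Edge) : Set where
      constructor ends
      field
        {base mid} : Vertex
        base∈B : base ∈ₛ B
        mid∈A  : mid ∈ₛ A
        joined : T (adj mid base)
        which  : (E.lo e ≡ mid × E.hi e ≡ base) ⊎ (E.lo e ≡ base × E.hi e ≡ mid)

    abstract
      ends-of : ∀ e → Ends e
      ends-of (edge l h _ l~h) with proj₂ bip l h l~h
      ... | inj₁ (l∈A , h∈B) = ends h∈B l∈A l~h (inj₁ (refl , refl))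
      ... | inj₂ (l∈B , h∈A) = ends l∈B h∈A (subst T (symmetric l h) l~h) (inj₂ (refl , refl))

    base mid : Edge → Vertex
    base e = Ends.base (ends-of e)
    mid e = Ends.mid (ends-of e)

    base≢mid : ∀ e f → base e ≢ mid f
    base≢mid e f eq = disjoint (Ends.mid∈A (ends-of f)) (subst (_∈ₛ B) eq (Ends.base∈B (ends-of e)))

    ends-determine : ∀ {e f} → base e ≡ base f → mid e ≡ mid f → e ≡ f
    ends-determine {e} {f} b m with Ends.which (ends-of e) | Ends.which (ends-of f)
    ... | inj₁ (l , h) | inj₁ (l′ , h′) = edge-≡ (trans l (trans m (sym l′))) (trans h (trans b (sym h′)))
    ... | inj₂ (l , h) | inj₂ (l′ , h′) = edge-≡ (trans l (trans b (sym l′))) (trans h (trans m (sym h′)))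
    -- If the stored orders disagreed, the same two vertices would be increasing in both orders.
    ... | inj₁ (l , h) | inj₂ (l′ , h′) = contradiction
      (subst₂ Fin._<_ (trans l (trans m (sym h′))) (trans h (trans b (sym l′))) (E.lo<hi e))
      (Finₚ.<-asym (E.lo<hi f))
    ... | inj₂ (l , h) | inj₁ (l′ , h′) = contradiction
      (subst₂ Fin._<_ (trans l (trans b (sym h′))) (trans h (trans m (sym l′))) (E.lo<hi e))
      (Finₚ.<-asym (E.lo<hi f))

    joined-at : ∀ {v f} → mid f ≡ v → T (adj v (base f))
    joined-at {f = f} refl = Ends.joined (ends-of f)

    joined-at′ : ∀ {v f} → base f ≡ v → T (adj v (mid f))
    joined-at′ {f = f} refl = subst T (symmetric (mid f) (base f)) (Ends.joined (ends-of f))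

    -- Distinct edges with the same end in `A` have distinct ends in `B`, so three of them would
    -- give a degree above 2.
    at-mid : ∀ {e f g} → mid f ≡ mid e → mid g ≡ mid e → f ≢ e → g ≢ e → g ≡ f
    at-mid {e} {f} {g} mf mg f≢e g≢e = decidable-stable (g ≟ᵉ f) λ g≢f → from-no (3 ≤? 2)
      (few-neighbours degA (Ends.mid∈A (ends-of e))
        ( (  (λ eq → f≢e (ends-determine (sym eq) mf)) ∷ (λ eq → g≢e (ends-determine (sym eq) mg)) ∷ [])
        ∷ ((λ eq → g≢f (ends-determine (sym eq) (trans mg (sym mf)))) ∷ []) ∷ [] ∷ [])
        (joined-at refl ∷ joined-at mf ∷ joined-at mg ∷ []))

    at-base : ∀ {e f g h} → base f ≡ base e → base g ≡ base e → base h ≡ base e →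
              f ≢ e → g ≢ e → g ≢ f → h ≢ e → h ≢ f → h ≡ g
    at-base {e} {f} {g} {h} bf bg bh f≢e g≢e g≢f h≢e h≢f = decidable-stable (h ≟ᵉ g) λ h≢g → from-no (4 ≤? 3)
      (few-neighbours degB (Ends.base∈B (ends-of e))
        ( (apart bf refl f≢e ∷ apart bg refl g≢e ∷ apart bh refl h≢e ∷ [])
        ∷ (apart bg bf g≢f ∷ apart bh bf h≢f ∷ []) ∷ (apart bh bg h≢g ∷ []) ∷ [] ∷ [])
        (joined-at′ refl ∷ joined-at′ bf ∷ joined-at′ bg ∷ joined-at′ bh ∷ []))
      where
      apart : ∀ {v x y} → base x ≡ v → base y ≡ v → x ≢ y → mid y ≢ mid x
      apart bx by x≢y eq = x≢y (ends-determine (trans bx (sym by)) (sym eq))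

    Opposite : Edge → Edge → Set
    Opposite e f = mid f ≡ mid e × f ≢ e

    opposite? : ∀ e → Decidable (Opposite e)
    opposite? e f = (mid f Finₚ.≟ mid e) ×-dec ¬? (f ≟ᵉ e)

    -- Its fixed points are the edges whose end in `A` has degree 1.
    rev : Edge → Edge
    rev e = find-or (opposite? e) e

    mid-rev : ∀ e → mid (rev e) ≡ mid e
    mid-rev e with find-or-spec (opposite? e) e
    ... | inj₁ (m , _) = m
    ... | inj₂ (eq , _) = cong mid eq

    rev-unique : ∀ {e f} → mid f ≡ mid e → f ≢ e → rev e ≡ f
    rev-unique {e} {f} m f≢e with find-or-spec (opposite? e) e
    ... | inj₁ (m′ , r≢e) = at-mid m m′ f≢e r≢e
    ... | inj₂ (_ , none) = contradiction (m , f≢e) (none f)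

    rev-involutive : ∀ {e} → rev e ≢ e → rev (rev e) ≡ e
    rev-involutive {e} r≢e = rev-unique (sym (mid-rev e)) (≢-sym r≢e)

    base-rev : ∀ {e} → rev e ≢ e → base (rev e) ≢ base e
    base-rev {e} r≢e b = r≢e (ends-determine b (mid-rev e))

    First : Edge → Edge → Set
    First e f = base f ≡ base e × f ≢ e

    first? : ∀ e → Decidable (First e)
    first? e f = (base f Finₚ.≟ base e) ×-dec ¬? (f ≟ᵉ e)

    sib₁ : Edge → Edge
    sib₁ e = find-or (first? e) e

    second? : ∀ e → Decidable (λ f → First e f × f ≢ sib₁ e)
    second? e f = first? e f ×-dec ¬? (f ≟ᵉ sib₁ e)

    sib₂ : Edge → Edge
    sib₂ e = find-or (second? e) e

    base-sib₁ : ∀ e → base (sib₁ e) ≡ base e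
    base-sib₁ e with find-or-spec (first? e) e
    ... | inj₁ (b , _) = b
    ... | inj₂ (eq , _) = cong base eq

    base-sib₂ : ∀ e → base (sib₂ e) ≡ base e
    base-sib₂ e with find-or-spec (second? e) e
    ... | inj₁ ((b , _) , _) = b
    ... | inj₂ (eq , _) = cong base eq

    -- Two searches exhaust the edges at a vertex of `B`, by the degree bound in `at-base`.
    siblings : ∀ e {f} → base f ≡ base e → f ∈ e ∷ sib₁ e ∷ sib₂ e ∷ []
    siblings e {f} b with f ≟ᵉ e | f ≟ᵉ sib₁ e
    ... | yes eq | _ = here eq
    ... | no _ | yes eq = there (here eq)
    ... | no f≢e | no f≢s with find-or-spec (first? e) e | find-or-spec (second? e) e
    ...   | inj₂ (_ , none) | _ = contradiction (b , f≢e) (none f)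
    ...   | inj₁ _ | inj₂ (_ , none) = contradiction ((b , f≢e) , f≢s) (none f)
    ...   | inj₁ (b₁ , n₁) | inj₁ ((b₂ , n₂) , n₃) =
      there (there (here (at-base b₁ b₂ b n₁ n₂ n₃ f≢e f≢s)))

    -- The dart system of the doubled graph.

    rev′ : Edge × Bool → Edge × Bool
    rev′ (e , i) with rev e ≟ᵉ e
    ... | yes _ = e , not i
    ... | no _ = rev e , i

    rev′-fixed : ∀ {e i} → rev e ≡ e → rev′ (e , i) ≡ (e , not i)
    rev′-fixed {e} eq with rev e ≟ᵉ e
    ... | yes _ = refl
    ... | no n = contradiction eq n

    rev′-moved : ∀ {e i} → rev e ≢ e → rev′ (e , i) ≡ (rev e , i)
    rev′-moved {e} n with rev e ≟ᵉ e
    ... | yes eq = contradiction eq n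
    ... | no _ = refl

    base′ : Edge × Bool → Vertex × Bool
    base′ (e , i) = base e , i

    rev′-involutive : ∀ d → rev′ (rev′ d) ≡ d
    rev′-involutive (e , i) = by-cases (rev e ≟ᵉ e)
      where
      by-cases : Dec (rev e ≡ e) → rev′ (rev′ (e , i)) ≡ (e , i)
      by-cases (yes eq) = trans (cong rev′ (rev′-fixed eq))
                         (trans (rev′-fixed eq) (cong (e ,_) (not-involutive i)))
      by-cases (no n) = trans (cong rev′ (rev′-moved n))
                       (trans (rev′-moved λ eq → n (trans (sym eq) (rev-involutive n)))
                              (cong (_, i) (rev-involutive n)))

    base′-rev′ : ∀ d → base′ (rev′ d) ≢ base′ d
    base′-rev′ (e , i) with rev e ≟ᵉ e
    ... | yes _ = λ eq → not-¬ refl (sym (cong proj₂ eq))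
    ... | no n = λ eq → base-rev n (cong proj₁ eq)

    -- Two copies of G, in which each edge at a vertex of A of degree 1 is
    -- paired with its own copy, so that rev has no fixed points.
    system : DartSystem
    system = record
      { Dart = Edge × Bool
      ; Vertex = Vertex × Bool
      ; _≟ᵈ_ = ≡-dec _≟ᵉ_ _≟ᵇ_
      ; _≟ᵛ_ = ≡-dec Finₚ._≟_ _≟ᵇ_
      ; search = λ Q? → map′ [ (λ (e , q) → (e , false) , q) , (λ (e , q) → (e , true) , q) ]′
                             (λ { ((e , false) , q) → inj₁ (e , q) ; ((e , true) , q) → inj₂ (e , q) })
                             (search-edge (λ e → Q? (e , false)) ⊎-dec search-edge (λ e → Q? (e , true)))
      ; vertices = cartesianProduct (allFin order) (false ∷ true ∷ [])
      ; base = base′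
      ; base∈vertices = λ (e , i) → ∈-cartesianProduct⁺ (∈-allFin (base e)) (bools i)
      ; rev = rev′
      ; rev-involutive = rev′-involutive
      ; base-rev = base′-rev′
      ; sib₁ = λ (e , i) → sib₁ e , i
      ; sib₂ = λ (e , i) → sib₂ e , i
      ; base-sib₁ = λ (e , i) → cong (_, i) (base-sib₁ e)
      ; base-sib₂ = λ (e , i) → cong (_, i) (base-sib₂ e)
      ; siblings = λ { (e , i) {f , j} eq → siblings′ e (cong proj₁ eq) (cong proj₂ eq) }
      }
      where
      bools : ∀ i → i ∈ false ∷ true ∷ []
      bools false = here refl
      bools true = there (here refl)
      siblings′ : ∀ e {i f j} → base f ≡ base e → j ≡ i → (f , j) ∈ (e , i) ∷ (sib₁ e , i) ∷ (sib₂ e , i) ∷ []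
      siblings′ e b refl = ∈-map⁺ (_, _) (siblings e b)

    -- Strong edge colourings from colourings of darts.

    end : ∀ {v} g → v ∈ᵉ g → v ≡ base g ⊎ v ≡ mid g
    end g v∈g with Ends.which (ends-of g) | v∈g
    ... | inj₁ (l , _) | inj₁ eq = inj₂ (trans eq l)
    ... | inj₁ (_ , h) | inj₂ eq = inj₁ (trans eq h)
    ... | inj₂ (l , _) | inj₁ eq = inj₁ (trans eq l)
    ... | inj₂ (_ , h) | inj₂ eq = inj₂ (trans eq h)

    base-end : ∀ {v} g e → v ≡ base g → v ∈ᵉ e → base g ≡ base e
    base-end g e v≡ v∈e with end e v∈e
    ... | inj₁ eq = trans (sym v≡) eq
    ... | inj₂ eq = contradiction (trans (sym v≡) eq) (base≢mid g e)

    mid-end : ∀ {v} g e → v ≡ mid g → v ∈ᵉ e → mid g ≡ mid e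
    mid-end g e v≡ v∈e with end e v∈e
    ... | inj₁ eq = contradiction (trans (sym eq) v≡) (base≢mid e g)
    ... | inj₂ eq = trans (sym v≡) eq

    module _ {φ : Edge → ℕ}
             (same-base : ∀ {e f} → e ≢ f → base e ≡ base f → φ e ≢ φ f)
             (linked : ∀ {e f} → e ≢ f → rev e ≢ e → base (rev e) ≡ base f → φ e ≢ φ f) where

      -- Two edges with a common end in `A` are each other's reversals, so this is the case of
      -- `linked` in which `f` is `rev e`.
      same-mid : ∀ {e f} → e ≢ f → mid e ≡ mid f → φ e ≢ φ f
      same-mid {e} {f} e≢f m = linked e≢f (λ eq → e≢f (trans (sym eq) r)) (cong base r)
        where
        r : rev e ≡ f
        r = rev-unique (sym m) (≢-sym e≢f)

      matching : ∀ {e f v} → φ e ≡ φ f → v ∈ᵉ e → v ∈ᵉ f → e ≡ f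
      matching {e} {f} {v} φ≡ v∈e v∈f = decidable-stable (e ≟ᵉ f) λ e≢f → by-end e≢f (end e v∈e)
        where
        by-end : e ≢ f → ¬ (v ≡ base e ⊎ v ≡ mid e)
        by-end e≢f (inj₁ v≡) = same-base e≢f (base-end e f v≡ v∈f) φ≡
        by-end e≢f (inj₂ v≡) = same-mid e≢f (mid-end e f v≡ v∈f) φ≡

      -- If `g` differs from `f`, then it is `rev f`, so `f` leads to the base of `e`. Either `f` is
      -- not `e`, and the two conflict, or `g` has both ends in common with `f`.
      induced : ∀ {g e f} → base g ≡ base e → mid g ≡ mid f → φ e ≡ φ f → φ g ≡ φ f
      induced {g} {e} {f} b m φ≡ with g ≟ᵉ f | f ≟ᵉ e
      ... | yes refl | _ = refl
      ... | no g≢f | yes refl = contradiction (ends-determine b m) g≢f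
      ... | no g≢f | no f≢e = contradiction (sym φ≡)
              (linked f≢e (λ eq → g≢f (trans (sym r) eq)) (trans (cong base r) b))
        where
        r : rev f ≡ g
        r = rev-unique m g≢f

      strong : IsStrongEdgeColouring φ
      strong c = (λ e f v φe φf → matching (trans φe (sym φf)))
               , λ { g (e , φe , lo∈e) (f , φf , hi∈f) → covered g e f φe φf lo∈e hi∈f (Ends.which (ends-of g)) }
        where
        covered : ∀ g e f → φ e ≡ c → φ f ≡ c → E.lo g ∈ᵉ e → E.hi g ∈ᵉ f → _ → φ g ≡ c
        covered g e f φe φf lo∈e hi∈f (inj₁ (l , h)) =
          trans (induced (base-end g f h hi∈f) (mid-end g e l lo∈e) (trans φf (sym φe))) φe
        covered g e f φe φf lo∈e hi∈f (inj₂ (l , h)) =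
          trans (induced (base-end g e l lo∈e) (mid-end g f h hi∈f) (trans φe (sym φf))) φf

    -- Both copies of an edge get the same list, and the colouring is read off one copy. Where `rev`
    -- moves an edge, `rev′` stays in that copy, so the required conflicts are present there.
    choosable : StrongChoosable 6
    choosable L uniq big
      with col , listed , distinct ← Colouring.colouring system (L ∘ proj₁) (λ (e , _) → uniq e , big e)
      = (λ e → col (e , false))
      , strong (λ e≢f b → distinct ((λ eq → e≢f (cong proj₁ eq)) , inj₁ (cong (_, false) b)))
               (λ e≢f moved b → distinct ((λ eq → e≢f (cong proj₁ eq)) ,
                 inj₂ (inj₁ (trans (cong base′ (rev′-moved moved)) (cong (_, false) b)))))
      , λ e → listed (e , false)

theorem1p4 : (G : Graph) → IsBipartiteWithDegrees 2 3 G → ch′ₛ G ≤ 6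
theorem1p4 G (A , B , bip , degA , degB) =
  proj₂ (ch′ₛ-smallest G) 6 (Incidences.choosable G bip degA degB)
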